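{- Let $m\ge 3$. Call $\mathbf{x}=(x_1,\ldots,x_m)\in\mathbb{R}^m$ generic if the $\binom{m}{2}$ midpoints $x_{ij}:=(x_i+x_j)/2$, $1\le i<j\le m$, are pairwise distinct (in particular the $x_i$ are pairwise distinct). For such $\mathbf{x}$ define its ranking pattern $$\mathrm{RP}^{\mathrm{UF}}(\mathbf{x})=\{(i_1\cdots i_m)\in\mathbb{P}_m:\ |y-x_{i_1}|<|y-x_{i_2}|<\cdots<|y-x_{i_m}|\text{ for some }y\in\mathbb{R}\},$$ where $\mathbb{P}_m$ is the set of permutations $(i_1\cdots i_m)$ of $[m]=\{1,\ldots,m\}$. Let $$r(m)=\bigl|\{\mathrm{RP}^{\mathrm{UF}}(\mathbf{x}):\ \mathbf{x}\in\mathbb{R}^m\text{ generic}\}\bigr|,\qquad r_0(m)=\bigl|\{\mathrm{RP}^{\mathrm{UF}}(\mathbf{x}):\ \mathbf{x}\in\mathbb{R}^m\text{ generic},\ x_1<\cdots<x_m\}\bigr|.$$ Let $\mathcal{M}_m$ be the mid-hyperplane arrangement in $\mathbb{R}^m$ consisting of the hyperplanes $\{x_i=x_j\}$ for $1\le i<j\le m$ together with the hyperplanes $\{x_i+x_j=x_k+x_l\}$ for all $(i,j,k,l)$ with $i,j,k,l$ pairwise distinct, $1\le i<j\le m$, $i<k<l\le m$. Then $$r(m)=\frac{m!}{2}\,r_0(m)=\frac{|\mathrm{ch}(\mathcal{M}_m)|}{2},$$ where $\mathrm{ch}(\mathcal{M}_m)$ denotes the set of chambers (connected components of the complement of the union of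 the hyperplanes) of $\mathcal{M}_m$.
   Context: Generic $\mathbf{x}$ are exactly the points of $\mathbb{R}^m$ not lying on any hyperplane of $\mathcal{M}_m$. -}

module Defs where

open import Data.Fin using (Fin; _<_)
open import Data.Fin.Permutation using (Permutation′; _⟨$⟩ʳ_)
open import Data.List using ([]; _∷_)
open import Data.List.Relation.Unary.Unique.Propositional using (Unique)
open import Data.Nat as ℕ using (ℕ)
import Data.Nat.Properties as ℕ
open import Data.Product using (Σ-syntax; ∃-syntax; _×_; _,_; proj₁; proj₂)
open import Data.Rational as ℚ using (ℚ; 0ℚ; ½)
import Data.Rational.Properties as ℚ
open import Data.Rational.Solver using (module +-*-Solver)
open import Data.Sum using (_⊎_; inj₁; inj₂)
open import Data.Vec.Functional using (Vector)
open import Function.Bundles using (Bijection)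
open import Level using (Level; 0ℓ)
open import Relation.Binary.Bundles using (Setoid)
import Relation.Binary.Construct.On as On
open import Relation.Binary.PropositionalEquality as ≡
  using (_≡_; _≢_; cong; sym; subst)
open import Relation.Unary
  using (Pred; _∈_; _⊆_; _∩_; _∪_; _≬_; _≐_; Satisfiable)
open import Relation.Unary.Relation.Binary.Equality using (≐-setoid)

private variable
  a ℓ p : Level

subsetoid : (S : Setoid a ℓ) → Pred (Setoid.Carrier S) p → Setoid _ _
subsetoid S P = On.setoid {B = Σ[ x ∈ Setoid.Carrier S ] P x} S proj₁

-- The elements of S, counted up to the equality of S, are n in number.
_HasCardinality_ : Setoid a ℓ → ℕ → Set _
S HasCardinality n = Bijection (≡.setoid (Fin n)) S

-- Real numbers: Cauchy sequences of rationals.  Two sequences denote the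
-- same number when neither is strictly below the other, that is, when
-- their difference tends to 0.

IsCauchy : (ℕ → ℚ) → Set
IsCauchy s = ∀ ε → 0ℚ ℚ.< ε →
  ∃[ N ] ∀ m n → N ℕ.≤ m → N ℕ.≤ n → ℚ.∣ s m ℚ.- s n ∣ ℚ.< ε

record ℝ : Set where
  constructor mkℝ
  field
    seq      : ℕ → ℚ
    isCauchy : IsCauchy seq

open ℝ public

½-pos : ∀ {ε} → 0ℚ ℚ.< ε → 0ℚ ℚ.< ½ ℚ.* ε
½-pos {ε} 0<ε = subst (ℚ._< ½ ℚ.* ε) (ℚ.*-zeroʳ ½) (ℚ.*-monoʳ-<-pos ½ 0<ε)

½+½ : ∀ ε → ½ ℚ.* ε ℚ.+ ½ ℚ.* ε ≡ ε
½+½ ε = ≡.trans (sym (ℚ.*-distribʳ-+ ε ½ ½)) (ℚ.*-identityˡ ε)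

-- Lipschitz maps of constant 1 (for the ℓ¹ distance in the binary case)
-- act termwise on Cauchy sequences.
lift₁ : (f : ℚ → ℚ) →
        (∀ p p′ → ℚ.∣ f p ℚ.- f p′ ∣ ℚ.≤ ℚ.∣ p ℚ.- p′ ∣) →
        ℝ → ℝ
lift₁ f lip x = mkℝ (λ n → f (seq x n)) λ ε 0<ε →
  let N , h = isCauchy x ε 0<ε in
  N , λ m n N≤m N≤n → ℚ.≤-<-trans (lip _ _) (h m n N≤m N≤n)

lift₂ : (f : ℚ → ℚ → ℚ) →
        (∀ p q p′ q′ → ℚ.∣ f p q ℚ.- f p′ q′ ∣ ℚ.≤
                       ℚ.∣ p ℚ.- p′ ∣ ℚ.+ ℚ.∣ q ℚ.- q′ ∣) →
        ℝ → ℝ → ℝ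
lift₂ f lip x y = mkℝ (λ n → f (seq x n) (seq y n)) λ ε 0<ε →
  let M , g = isCauchy x (½ ℚ.* ε) (½-pos 0<ε)
      N , h = isCauchy y (½ ℚ.* ε) (½-pos 0<ε)
  in M ℕ.⊔ N , λ m n l≤m l≤n →
     subst (ℚ._<_ _) (½+½ ε)
       (ℚ.≤-<-trans (lip _ _ _ _)
         (ℚ.+-mono-<
           (g m n (ℕ.m⊔n≤o⇒m≤o M N l≤m) (ℕ.m⊔n≤o⇒m≤o M N l≤n))
           (h m n (ℕ.m⊔n≤o⇒n≤o M N l≤m) (ℕ.m⊔n≤o⇒n≤o M N l≤n))))

+-lip : ∀ p q p′ q′ → ℚ.∣ (p ℚ.+ q) ℚ.- (p′ ℚ.+ q′) ∣ ℚ.≤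
                      ℚ.∣ p ℚ.- p′ ∣ ℚ.+ ℚ.∣ q ℚ.- q′ ∣
+-lip p q p′ q′ = begin
  ℚ.∣ (p ℚ.+ q) ℚ.- (p′ ℚ.+ q′) ∣    ≡⟨ cong ℚ.∣_∣ regroup ⟩
  ℚ.∣ (p ℚ.- p′) ℚ.+ (q ℚ.- q′) ∣    ≤⟨ ℚ.∣p+q∣≤∣p∣+∣q∣ (p ℚ.- p′) (q ℚ.- q′) ⟩
  ℚ.∣ p ℚ.- p′ ∣ ℚ.+ ℚ.∣ q ℚ.- q′ ∣  ∎
  where
  open ℚ.≤-Reasoning
  open +-*-Solver
  regroup : (p ℚ.+ q) ℚ.- (p′ ℚ.+ q′) ≡ (p ℚ.- p′) ℚ.+ (q ℚ.- q′)
  regroup = solve 4 (λ p q p′ q′ →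
    (p :+ q) :- (p′ :+ q′) := (p :- p′) :+ (q :- q′)) ≡.refl p q p′ q′

neg-lip : ∀ p p′ → ℚ.∣ (ℚ.- p) ℚ.- (ℚ.- p′) ∣ ℚ.≤ ℚ.∣ p ℚ.- p′ ∣
neg-lip p p′ = ℚ.≤-reflexive
  (≡.trans (cong ℚ.∣_∣ (sym (ℚ.neg-distrib-+ p (ℚ.- p′))))
           (ℚ.∣-p∣≡∣p∣ (p ℚ.- p′)))

half-lip : ∀ p p′ → ℚ.∣ ½ ℚ.* p ℚ.- ½ ℚ.* p′ ∣ ℚ.≤ ℚ.∣ p ℚ.- p′ ∣
half-lip p p′ = begin
  ℚ.∣ ½ ℚ.* p ℚ.- ½ ℚ.* p′ ∣  ≡⟨ cong ℚ.∣_∣ factor ⟩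
  ℚ.∣ ½ ℚ.* (p ℚ.- p′) ∣      ≡⟨ ℚ.∣p*q∣≡∣p∣*∣q∣ ½ (p ℚ.- p′) ⟩
  ½ ℚ.* d                     ≡⟨ ℚ.+-identityʳ (½ ℚ.* d) ⟨
  ½ ℚ.* d ℚ.+ 0ℚ              ≤⟨ ℚ.+-monoʳ-≤ (½ ℚ.* d) 0≤½d ⟩
  ½ ℚ.* d ℚ.+ ½ ℚ.* d         ≡⟨ ½+½ d ⟩
  d                           ∎
  where
  open ℚ.≤-Reasoning
  d = ℚ.∣ p ℚ.- p′ ∣
  0≤½d : 0ℚ ℚ.≤ ½ ℚ.* d
  0≤½d = subst (ℚ._≤ ½ ℚ.* d) (ℚ.*-zeroʳ ½)
    (ℚ.*-monoˡ-≤-nonNeg ½ (ℚ.0≤∣p∣ (p ℚ.- p′)))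
  factor : ½ ℚ.* p ℚ.- ½ ℚ.* p′ ≡ ½ ℚ.* (p ℚ.- p′)
  factor = ≡.trans (cong (½ ℚ.* p ℚ.+_) (ℚ.neg-distribʳ-* ½ p′))
                   (sym (ℚ.*-distribˡ-+ ½ p (ℚ.- p′)))

∣p∣-∣q∣≤∣p-q∣ : ∀ p q → ℚ.∣ p ∣ ℚ.- ℚ.∣ q ∣ ℚ.≤ ℚ.∣ p ℚ.- q ∣
∣p∣-∣q∣≤∣p-q∣ p q = begin
  ℚ.∣ p ∣ ℚ.- ℚ.∣ q ∣
    ≡⟨ cong (λ t → ℚ.∣ t ∣ ℚ.- ℚ.∣ q ∣)
         (solve 2 (λ p q → p := (p :- q) :+ q) ≡.refl p q) ⟩
  ℚ.∣ (p ℚ.- q) ℚ.+ q ∣ ℚ.- ℚ.∣ q ∣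
    ≤⟨ ℚ.+-monoˡ-≤ (ℚ.- ℚ.∣ q ∣) (ℚ.∣p+q∣≤∣p∣+∣q∣ (p ℚ.- q) q) ⟩
  (ℚ.∣ p ℚ.- q ∣ ℚ.+ ℚ.∣ q ∣) ℚ.- ℚ.∣ q ∣
    ≡⟨ solve 2 (λ a b → (a :+ b) :- b := a) ≡.refl ℚ.∣ p ℚ.- q ∣ ℚ.∣ q ∣ ⟩
  ℚ.∣ p ℚ.- q ∣ ∎
  where
  open ℚ.≤-Reasoning
  open +-*-Solver

abs-lip : ∀ p p′ → ℚ.∣ ℚ.∣ p ∣ ℚ.- ℚ.∣ p′ ∣ ∣ ℚ.≤ ℚ.∣ p ℚ.- p′ ∣
abs-lip p p′ with ℚ.∣p∣≡p∨∣p∣≡-p (ℚ.∣ p ∣ ℚ.- ℚ.∣ p′ ∣)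
... | inj₁ e = subst (ℚ._≤ ℚ.∣ p ℚ.- p′ ∣) (sym e) (∣p∣-∣q∣≤∣p-q∣ p p′)
... | inj₂ e = begin
  ℚ.∣ ℚ.∣ p ∣ ℚ.- ℚ.∣ p′ ∣ ∣   ≡⟨ e ⟩
  ℚ.- (ℚ.∣ p ∣ ℚ.- ℚ.∣ p′ ∣)   ≡⟨ swap ℚ.∣ p ∣ ℚ.∣ p′ ∣ ⟩
  ℚ.∣ p′ ∣ ℚ.- ℚ.∣ p ∣         ≤⟨ ∣p∣-∣q∣≤∣p-q∣ p′ p ⟩
  ℚ.∣ p′ ℚ.- p ∣               ≡⟨ cong ℚ.∣_∣ (swap p p′) ⟨
  ℚ.∣ ℚ.- (p ℚ.- p′) ∣         ≡⟨ ℚ.∣-p∣≡∣p∣ (p ℚ.- p′) ⟩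
  ℚ.∣ p ℚ.- p′ ∣               ∎
  where
  open ℚ.≤-Reasoning
  open +-*-Solver
  swap : ∀ a b → ℚ.- (a ℚ.- b) ≡ b ℚ.- a
  swap = solve 2 (λ a b → :- (a :- b) := b :- a) ≡.refl

const : ℚ → ℝ
const q = mkℝ (λ _ → q) λ ε 0<ε → 0 , λ _ _ _ _ →
  subst (ℚ._< ε) (cong ℚ.∣_∣ (sym (ℚ.+-inverseʳ q))) 0<ε

0ℝ : ℝ
0ℝ = const 0ℚ

infix  8 -_
infixl 6 _+_ _-_
infix  4 _<ᴿ_ _#_

_+_ : ℝ → ℝ → ℝ
_+_ = lift₂ ℚ._+_ +-lip

-_ : ℝ → ℝ
-_ = lift₁ ℚ.-_ neg-lip

_-_ : ℝ → ℝ → ℝ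
x - y = x + (- y)

half : ℝ → ℝ
half = lift₁ (½ ℚ.*_) half-lip

∣_∣ : ℝ → ℝ
∣_∣ = lift₁ ℚ.∣_∣ abs-lip

_<ᴿ_ : ℝ → ℝ → Set
x <ᴿ y = ∃[ ε ] 0ℚ ℚ.< ε × ∃[ N ] (∀ n → N ℕ.≤ n → seq x n ℚ.+ ε ℚ.< seq y n)

-- Apartness is the constructive form of x ≠ y: classically the two agree.
_#_ : ℝ → ℝ → Set
x # y = x <ᴿ y ⊎ y <ᴿ x

ℝ^_ : ℕ → Set
ℝ^ m = Vector ℝ m

Subset : ℕ → Set₁
Subset m = Pred (ℝ^ m) 0ℓ

private variable
  m : ℕ

-- The sup-norm balls generate the usual topology.
Open : Subset m → Set
Open U = ∀ x → x ∈ U →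
  ∃[ ε ] 0ℝ <ᴿ ε × (∀ y → (∀ i → ∣ x i - y i ∣ <ᴿ ε) → y ∈ U)

-- Positive form of: no two open sets covering C, each meeting C, have
-- intersection disjoint from C.
Connected : Subset m → Set₁
Connected {m} C = ∀ (U V : Subset m) → Open U → Open V →
  C ⊆ U ∪ V → C ≬ U → C ≬ V → C ≬ (U ∩ V)

-- Components are the maximal inhabited connected subsets.
_IsComponentOf_ : Subset m → Subset m → Set₁
_IsComponentOf_ {m} C X =
  C ⊆ X × Satisfiable C × Connected C ×
  (∀ (D : Subset m) → D ⊆ X → Connected D → C ⊆ D → D ⊆ C)

Components : Subset m → Setoid _ _
Components {m} X = subsetoid (≐-setoid (ℝ^ m) 0ℓ) (_IsComponentOf X)

midpoint : ℝ^ m → Fin m → Fin m → ℝ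
midpoint x i j = half (x i + x j)

Generic : Subset m
Generic {m} x = ∀ (i j k l : Fin m) → i < j → k < l → (i , j) ≢ (k , l) →
  midpoint x i j # midpoint x k l

Increasing : Subset m
Increasing {m} x = ∀ (i j : Fin m) → i < j → x i <ᴿ x j

-- The permutation (i₁ ⋯ iₘ) is the π with π ⟨$⟩ʳ a = iₐ.
RP : ℝ^ m → Pred (Permutation′ m) 0ℓ
RP {m} x π = ∃[ y ] ∀ (a b : Fin m) → a < b →
  ∣ y - x (π ⟨$⟩ʳ a) ∣ <ᴿ ∣ y - x (π ⟨$⟩ʳ b) ∣

-- {RP x : x ∈ P}, as a family of sets of permutations.
RankingPatterns : Subset m → Setoid _ _
RankingPatterns {m} P = subsetoid (≐-setoid (Permutation′ m) 0ℓ)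
  (λ S → ∃[ x ] x ∈ P × S ≐ RP x)

data MidHyperplane (m : ℕ) : Set where
  equal : (i j : Fin m) → i < j → MidHyperplane m
  mid   : (i j k l : Fin m) → Unique (i ∷ j ∷ k ∷ l ∷ []) →
          i < j → i < k → k < l → MidHyperplane m

-- The hyperplane H is {x : lhs H x = rhs H x}.
lhs rhs : MidHyperplane m → ℝ^ m → ℝ
lhs (equal i j _)         x = x i
lhs (mid i j k l _ _ _ _) x = x i + x j
rhs (equal i j _)         x = x j
rhs (mid i j k l _ _ _ _) x = x k + x l

ArrangementComplement : Subset m
ArrangementComplement {m} x = ∀ (H : MidHyperplane m) → lhs H x # rhs H x

Chambers : ℕ → Setoid _ _
Chambers m = Components (ArrangementComplement {m})

{-# OPTIONS --safe #-}

-- Sign conditions on sums x i + x j are open, so every question about real configurations reduces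
-- to rational ones: a late term of the defining Cauchy sequences satisfies the same strict
-- inequalities.  A rational configuration counts up to _∼_, the relation of ordering all midpoints
-- alike.
--
-- Fourier–Motzkin elimination decides which orders of the midpoints occur, so there are finitely
-- many classes.  Each class spans a convex, hence connected, region of ℝ^m, and these regions are
-- the chambers.
--
-- A permutation is a ranking of x exactly when all midpoints of its descents are below all
-- midpoints of its ascents, so the ranking pattern depends on the class only.  Conversely, the
-- pattern contains the increasing order of the coordinates together with its reverse, which
-- determines that order up to reflection, and then a midpoint lies below another iff a point
-- between them produces a suitable ranking.  Thus a pattern comes from exactly two mirror-image
-- chambers, while permuting coordinates acts freely on chambers with the increasing ones as orbit
-- representatives.
module Submission where

open import Data.Nat using (ℕ; _≤_; _*_; _!)
open import Data.Product using (∃-syntax; _×_)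
open import Relation.Binary.PropositionalEquality using (_≡_)
open import Relation.Unary using (_∩_)
open import Defs using (_HasCardinality_; RankingPatterns; Generic; Increasing; Chambers)

open import Data.Fin as Fin using (Fin; zero; suc; toℕ; inject₁; opposite; punchIn)
open import Data.Fin.Induction using (<-weakInduction)
open import Data.Fin.Permutation as Perm using (Permutation′; _⟨$⟩ʳ_; _⟨$⟩ˡ_; _∘ₚ_)
import Data.Fin.Properties as Fin
import Data.Integer as ℤ
import Data.Integer.Properties as ℤ
open import Data.List
  using (List; []; _∷_; _++_; map; allFin; cartesianProduct; cartesianProductWith; filter)
import Data.List.Membership.Propositional.Properties as Membership
open import Data.List.Relation.Unary.All as All using (All; []; _∷_)
import Data.List.Relation.Unary.All.Properties as All
open import Data.List.Relation.Unary.AllPairs using ([]; _∷_)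
open import Data.List.Relation.Unary.Any as Any using (Any; here; there)
import Data.List.Relation.Unary.Any.Properties as Any
open import Data.Nat as ℕ using ()
import Data.Nat.Coprimality as Coprimality
import Data.Nat.Properties as ℕ
open import Data.Product using (Σ; ∃; _,_; proj₁; proj₂)
open import Data.Product.Relation.Binary.Pointwise.NonDependent using (_×ₛ_)
open import Data.Rational as ℚ using (ℚ; 0ℚ; 1ℚ; ½; _+_; _-_; -_; _<_; ∣_∣)
import Data.Rational.Properties as ℚ
open import Data.Rational.Solver using (module +-*-Solver)
import Data.Rational.Unnormalised as ℚᵘ
import Data.Rational.Unnormalised.Properties as ℚᵘ
open import Data.Sum as Sum using (_⊎_; inj₁; inj₂)
import Data.Vec.Functional as Vector
open import Function using (_∘_; id; case_of_)
open import Function.Bundles using (Bijection)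
open import Function.Construct.Composition using (bijection)
open import Function.Construct.Identity using () renaming (bijection to id-bijection)
open import Function.Definitions using (Congruent; Injective; StrictlySurjective)
open import Level using (Level)
open import Relation.Binary.Bundles using (Setoid; DecSetoid)
open import Relation.Binary.Definitions using (tri<; tri≈; tri>)
open import Relation.Binary.PropositionalEquality as ≡ using (refl; _≢_)
open import Relation.Nullary
  using (¬_; Dec; yes; no; contradiction; ¬?; _×-dec_; _⊎-dec_; _→-dec_)
open import Relation.Nullary.Decidable using (map′)
open import Relation.Unary using (_∈_; _⊆_; _∪_; _≬_; _≐_)
open import Defs as ℝ using
  (ℝ; mkℝ; seq; isCauchy; const; half; midpoint; _<ᴿ_; _#_; ℝ^_; Subset; Open; Connected;
   _IsComponentOf_; equal; mid; ArrangementComplement; RP; ½-pos; ½+½)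

open +-*-Solver using (solve; _:+_; _:-_; _:*_; :-_; _:=_; con)

-- The order of these reals is undecidable, whereas counting classes needs a decidable equivalence.
-- Hence all three families are put in bijection with setoids of rational configurations, and a real
-- point matters only through the strict inequalities it shares with a rational one.
--
-- The hard point is the connectedness of a region. Each of its points comes with a side, `U` or
-- `V`, but this choice is a mere function on Cauchy sequences without any continuity, and a limit
-- has to be built by hand as such a sequence. So a segment is bisected according to the side chosen
-- at its midpoint, and the limit is a diagonal sequence. Limits do not preserve strict inequalities
-- in general; here they do, because at every fixed index a gap common to both ends is a
-- midpoint-convex condition, which all later ends inherit with the same constant.

private variable
  m n : ℕ
  ℓ₁ ℓ₂ ℓ₃ ℓ₄ : Level

-- Counting setoids

card-unique : (S : Setoid ℓ₁ ℓ₂) {m n : ℕ} →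
              S HasCardinality m → S HasCardinality n → m ≡ n
card-unique S f g = ℕ.≤-antisym (le f g) (le g f)
  where
  open Setoid S using (trans; sym)
  le : ∀ {m n} → S HasCardinality m → S HasCardinality n → m ℕ.≤ n
  le f g = Fin.injective⇒≤ λ {i} {j} eq → Bijection.injective f
    (trans (sym (proj₂ (Bijection.strictlySurjective g (Bijection.to f i))))
      (trans (Bijection.cong g eq)
        (proj₂ (Bijection.strictlySurjective g (Bijection.to f j)))))

card-× : {S : Setoid ℓ₁ ℓ₂} {T : Setoid ℓ₃ ℓ₄} {m n : ℕ} →
         S HasCardinality m → T HasCardinality n → (S ×ₛ T) HasCardinality (m ℕ.* n)
card-× {S = S} {T} {m} {n} f g = record
  { to        = λ k → to f (proj₁ (Fin.remQuot n k)) , to g (proj₂ (Fin.remQuot {m} n k))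
  ; cong      = λ { refl → Setoid.refl S , Setoid.refl T }
  ; bijective =
      (λ {i} {j} (p , q) → ≡.trans (≡.sym (Fin.combine-remQuot {m} n i))
        (≡.trans (≡.cong₂ Fin.combine (injective f p) (injective g q))
                 (Fin.combine-remQuot {m} n j)))
    , λ (s , t) → let i , p = strictlySurjective f s
                      j , q = strictlySurjective g t
                  in Fin.combine i j , λ { refl →
                     ≡.subst (λ ij → Setoid._≈_ S (to f (proj₁ ij)) s ×
                                     Setoid._≈_ T (to g (proj₂ ij)) t)
                             (≡.sym (Fin.remQuot-combine i j)) (p , q) }
  }
  where open Bijection

module _ (S : DecSetoid ℓ₁ ℓ₂) where
  open DecSetoid S hiding (refl)

  -- Built from the end of the list: an element becomes a representative only if none chosen from
  -- its tail is equivalent to it. Decidability thus turns a covering list with repetitions into an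
  -- exact count.
  transversal : (xs : List Carrier) → ∃[ n ] ∃ λ (f : Fin n → Carrier) →
    Injective _≡_ _≈_ f × (∀ y → Any (_≈ y) xs → ∃[ i ] f i ≈ y)
  transversal [] = 0 , (λ ()) , (λ { {()} }) , λ _ ()
  transversal (x ∷ xs) with transversal xs
  ... | n , f , f-inj , f-covers with Fin.any? (λ i → f i ≟ x)
  ...   | yes (i , fi≈x) = n , f , f-inj , λ where
          y (here x≈y)  → i , trans fi≈x x≈y
          y (there any) → f-covers y any
  ...   | no x-new = ℕ.suc n , x Vector.∷ f , inj , λ where
          y (here x≈y)  → zero , x≈y
          y (there any) → let i , fi≈y = f-covers y any in suc i , fi≈y
    where
    inj : Injective _≡_ _≈_ (x Vector.∷ f)
    inj {zero}  {zero}  _  = refl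
    inj {zero}  {suc j} eq = contradiction (j , sym eq) x-new
    inj {suc i} {zero}  eq = contradiction (i , eq) x-new
    inj {suc i} {suc j} eq = ≡.cong suc (f-inj eq)

  covered⇒finite : (xs : List Carrier) → (∀ y → Any (_≈ y) xs) →
                   ∃[ n ] setoid HasCardinality n
  covered⇒finite xs covers = let n , f , f-inj , f-covers = transversal xs in
    n , record
      { to        = f
      ; cong      = λ { refl → DecSetoid.refl S }
      ; bijective = f-inj , λ y → let i , fi≈y = f-covers y (covers y) in
                                  i , λ { refl → fi≈y }
      }

-- Linear arithmetic over ℚ

-- The equation says that `Q - P` and `q - p` agree. Every linear inequality below is obtained by
-- adding up hypotheses into `P < Q` and leaving this equation to the ring solver.
shift-< : ∀ {p q P Q} → P < Q → P + q ≡ p + Q → p < q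
shift-< {p} {q} {P} {Q} P<Q eq = ≡.subst₂ _<_
  (≡.trans (≡.cong (_- Q) (≡.trans (ℚ.+-comm q P) eq))
           (solve 2 (λ p Q → (p :+ Q) :- Q := p) refl p Q))
  (solve 2 (λ q Q → (q :+ Q) :- Q := q) refl q Q)
  (ℚ.+-monoˡ-< (- Q) (ℚ.+-monoʳ-< q P<Q))

p≤∣p∣ : ∀ p → p ℚ.≤ ∣ p ∣
p≤∣p∣ p with ℚ.≤-total 0ℚ p
... | inj₁ 0≤p = ℚ.≤-reflexive (≡.sym (ℚ.0≤p⇒∣p∣≡p 0≤p))
... | inj₂ p≤0 = ℚ.≤-trans p≤0 (ℚ.0≤∣p∣ p)

-p≤∣p∣ : ∀ p → - p ℚ.≤ ∣ p ∣
-p≤∣p∣ p = ≡.subst (- p ℚ.≤_) (ℚ.∣-p∣≡∣p∣ p) (p≤∣p∣ (- p))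

close⁻ˡ : ∀ {a b e} → ∣ a - b ∣ < e → a < b + e
close⁻ˡ {a} {b} {e} h = shift-< (ℚ.≤-<-trans (p≤∣p∣ (a - b)) h)
  (solve 3 (λ a b e → (a :- b) :+ (b :+ e) := a :+ e) refl a b e)

close⁻ʳ : ∀ {a b e} → ∣ a - b ∣ < e → b < a + e
close⁻ʳ {a} {b} {e} h = shift-< (ℚ.≤-<-trans (-p≤∣p∣ (a - b)) h)
  (solve 3 (λ a b e → :- (a :- b) :+ (a :+ e) := b :+ e) refl a b e)

close⁺ : ∀ {a b e} → a < b + e → b < a + e → ∣ a - b ∣ < e
close⁺ {a} {b} {e} h k with ℚ.∣p∣≡p∨∣p∣≡-p (a - b)
... | inj₁ eq = ≡.subst (_< e) (≡.sym eq) (shift-< h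
  (solve 3 (λ a b e → a :+ e := (a :- b) :+ (b :+ e)) refl a b e))
... | inj₂ eq = ≡.subst (_< e) (≡.sym eq) (shift-< k
  (solve 3 (λ a b e → b :+ e := :- (a :- b) :+ (a :+ e)) refl a b e))

p<p+e : ∀ p {e} → 0ℚ < e → p < p + e
p<p+e p {e} 0<e = shift-< 0<e (solve 2 (λ p e → con 0ℚ :+ (p :+ e) := p :+ e) refl p e)

p-e<p : ∀ p {e} → 0ℚ < e → p - e < p
p-e<p p {e} 0<e = shift-< 0<e (solve 2 (λ p e → con 0ℚ :+ p := p :- e :+ e) refl p e)

+-pos : ∀ {p q} → 0ℚ < p → 0ℚ < q → 0ℚ < p + q
+-pos h k = ℚ.+-mono-< h k

0<1 : 0ℚ < 1ℚ
0<1 = ℚ.positive⁻¹ 1ℚ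

⊓-pos : ∀ {p q} → 0ℚ < p → 0ℚ < q → 0ℚ < p ℚ.⊓ q
⊓-pos {p} {q} h k with ℚ.⊓-sel p q
... | inj₁ eq = ≡.subst (0ℚ <_) (≡.sym eq) h
... | inj₂ eq = ≡.subst (0ℚ <_) (≡.sym eq) k

-- The hypotheses are the two halves of `∣ y - u ∣ < v - y - e`, and `v - y` is at most `∣ y - v ∣`.
-- The slack `e` is carried along because the order of the reals asks for one gap at all late
-- indices.
distance-< : ∀ {y u v e} → u + e < v → y + y + e < u + v → ∣ y - u ∣ + e < ∣ y - v ∣
distance-< {y} {u} {v} {e} u<v 2y<u+v = ℚ.<-≤-trans
  (shift-< (close⁺ {y} {u} {v - y - e}
    (shift-< 2y<u+v (solve 4 (λ y u v e → y :+ y :+ e :+ (u :+ (v :- y :- e)) := y :+ (u :+ v))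
      refl y u v e))
    (shift-< u<v (solve 4 (λ y u v e → u :+ e :+ (y :+ (v :- y :- e)) := u :+ v) refl y u v e)))
    (solve 4 (λ A y v e → A :+ (v :- y) := A :+ e :+ (v :- y :- e)) refl (∣ y - u ∣) y v e))
  (≡.subst (ℚ._≤ ∣ y - v ∣) (solve 2 (λ y v → :- (y :- v) := v :- y) refl y v) (-p≤∣p∣ (y - v)))

neg-distance : ∀ y u → ∣ - y - - u ∣ ≡ ∣ y - u ∣
neg-distance y u = ≡.trans (≡.cong ∣_∣ (solve 2 (λ y u → :- y :- :- u := :- (y :- u)) refl y u))
    (ℚ.∣-p∣≡∣p∣ (y - u))

distance-> : ∀ {y u v e} → v + e < u → u + v + e < y + y → ∣ y - u ∣ + e < ∣ y - v ∣
distance-> {y} {u} {v} {e} v<u u+v<2y = ≡.subst₂ (λ A B → A + e < B) (neg-distance y u)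
    (neg-distance y v)
  (distance-< { - y} { - u} { - v} {e}
    (shift-< v<u (solve 3 (λ u v e → v :+ e :+ :- v := :- u :+ e :+ u) refl u v e))
    (shift-< u+v<2y (solve 4 (λ y u v e → u :+ v :+ e :+ (:- u :+ :- v) :=
      :- y :+ :- y :+ e :+ (y :+ y)) refl y u v e)))

-- If `∣ y - v ∣` is `y - v`, the hypothesis forces `v < u`; otherwise it gives `y - u < v - y`.
distance⁻-< : ∀ {y u v} → u < v → ∣ y - u ∣ < ∣ y - v ∣ → y + y < u + v
distance⁻-< {y} {u} {v} u<v h with ℚ.∣p∣≡p∨∣p∣≡-p (y - v)
... | inj₁ eq = contradiction
  (shift-< (ℚ.≤-<-trans (p≤∣p∣ (y - u)) (≡.subst (∣ y - u ∣ <_) eq h))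
    (solve 3 (λ y u v → y :- u :+ u := v :+ (y :- v)) refl y u v))
  (ℚ.<-asym u<v)
... | inj₂ eq = shift-< (ℚ.≤-<-trans (p≤∣p∣ (y - u)) (≡.subst (∣ y - u ∣ <_) eq h))
    (solve 3 (λ y u v → y :- u :+ (u :+ v) := y :+ y :+ :- (y :- v)) refl y u v)

distance⁻-> : ∀ {y u v} → v < u → ∣ y - u ∣ < ∣ y - v ∣ → u + v < y + y
distance⁻-> {y} {u} {v} v<u h = shift-<
  (distance⁻-< {y = - y} {u = - u} {v = - v} (ℚ.neg-antimono-< v<u)
    (≡.subst₂ _<_ (≡.sym (neg-distance y u)) (≡.sym (neg-distance y v)) h))
  (solve 3 (λ y u v → :- y :+ :- y :+ (y :+ y) := u :+ v :+ (:- u :+ :- v)) refl y u v)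

closer-< : ∀ {y u v} → u < v → y + y < u + v → ∣ y - u ∣ < ∣ y - v ∣
closer-< {y} {u} {v} h k = ≡.subst (_< ∣ y - v ∣) (ℚ.+-identityʳ ∣ y - u ∣)
  (distance-< {y} (≡.subst (_< v) (≡.sym (ℚ.+-identityʳ u)) h)
    (≡.subst (_< u + v) (≡.sym (ℚ.+-identityʳ (y + y))) k))

closer-> : ∀ {y u v} → v < u → u + v < y + y → ∣ y - u ∣ < ∣ y - v ∣
closer-> {y} {u} {v} h k = ≡.subst (_< ∣ y - v ∣) (ℚ.+-identityʳ ∣ y - u ∣)
  (distance-> {y} (≡.subst (_< u) (≡.sym (ℚ.+-identityʳ v)) h)
    (≡.subst (_< y + y) (≡.sym (ℚ.+-identityʳ (u + v))) k))

∣∣-injective : ∀ p q → ∣ p ∣ ≡ ∣ q ∣ → p ≡ q ⊎ p ≡ - q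
∣∣-injective p q eq with ℚ.∣p∣≡p∨∣p∣≡-p p | ℚ.∣p∣≡p∨∣p∣≡-p q
... | inj₁ h | inj₁ k = inj₁ (≡.trans (≡.sym h) (≡.trans eq k))
... | inj₁ h | inj₂ k = inj₂ (≡.trans (≡.sym h) (≡.trans eq k))
... | inj₂ h | inj₁ k = inj₂ (ℚ.neg-injective
    (≡.trans (≡.sym h) (≡.trans eq (≡.trans k (solve 1 (λ q → q := :- :- q) refl q)))))
... | inj₂ h | inj₂ k = inj₁ (ℚ.neg-injective (≡.trans (≡.sym h) (≡.trans eq k)))

equidistant : ∀ y u v → ∣ y - u ∣ ≡ ∣ y - v ∣ → u ≡ v ⊎ y ≡ ½ ℚ.* (u + v)
equidistant y u v eq with ∣∣-injective (y - u) (y - v) eq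
... | inj₁ h = inj₁ (≡.trans (solve 2 (λ y u → u := y :- (y :- u)) refl y u)
                 (≡.trans (≡.cong (λ d → y - d) h) (solve 2 (λ y v → y :- (y :- v) := v) refl y v)))
... | inj₂ h = inj₂ (≡.trans (solve 2 (λ y u → y := con ½ :* (y :- u :+ (y :+ u))) refl y u)
                 (≡.trans (≡.cong (λ d → ½ ℚ.* (d + (y + u))) h)
                   (solve 3 (λ y u v → con ½ :* (:- (y :- v) :+ (y :+ u)) := con ½ :* (u :+ v))
                     refl y u v)))

½<⇒<double : ∀ {s y} → ½ ℚ.* s < y → s < y + y
½<⇒<double {s} {y} h = ≡.subst (_< y + y) (½+½ s) (ℚ.+-mono-< h h)

<½⇒double< : ∀ {s y} → y < ½ ℚ.* s → y + y < s
<½⇒double< {s} {y} h = ≡.subst (y + y <_) (½+½ s) (ℚ.+-mono-< h h)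

≤∧≢⇒< : ∀ {p q} → p ℚ.≤ q → p ≢ q → p < q
≤∧≢⇒< p≤q p≢q = ℚ.≰⇒> λ q≤p → p≢q (ℚ.≤-antisym p≤q q≤p)

-- Archimedean property

halve : ℕ → ℚ → ℚ
halve ℕ.zero    p = p
halve (ℕ.suc n) p = ½ ℚ.* halve n p

ι : ℕ → ℚ
ι n = ℚ.mkℚ (ℤ.+ n) 0 (Coprimality.sym (Coprimality.1-coprimeTo n))

ι-+ : ∀ m n → ι (m ℕ.+ n) ≡ ι m + ι n
ι-+ m n = ℚ.toℚᵘ-injective (ℚᵘ.≃-trans
  (ℚᵘ.*≡* (≡.cong (ℤ._* ℤ.+ 1) (≡.sym (≡.cong₂ ℤ._+_ (ℤ.*-identityʳ (ℤ.+ m))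
    (ℤ.*-identityʳ (ℤ.+ n))))))
  (ℚᵘ.≃-sym (ℚ.toℚᵘ-homo-+ (ι m) (ι n))))

archimedean : ∀ p {q} → 0ℚ < q → ∃[ n ] p < ι n ℚ.* q
archimedean p {ℚ.mkℚ (ℤ.+ 0)           d _} (ℚ.*<* (ℤ.+<+ ()))
archimedean p {ℚ.mkℚ ℤ.-[1+ a ]      d _} (ℚ.*<* ())
archimedean p@(ℚ.mkℚ _ _ _) {q@(ℚ.mkℚ (ℤ.+ ℕ.suc a) d _)} _ = N ,
  ℚ.toℚᵘ-cancel-< (ℚᵘ.<-respʳ-≃ (ℚᵘ.≃-sym (ℚ.toℚᵘ-homo-* (ι N) q)) (ℚᵘ.*<* (begin-strict
    ℚ.↥ p ℤ.* ℤ.+ (1 ℕ.* ℕ.suc d)                  ≤⟨ ℤ.*-monoʳ-≤-nonNeg (ℤ.+ (1 ℕ.* ℕ.suc d)) (z≤+∣z∣ (ℚ.↥ p)) ⟩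
    ℤ.+ ℤ.∣ ℚ.↥ p ∣ ℤ.* ℤ.+ (1 ℕ.* ℕ.suc d)           ≡⟨ ≡.cong (ℤ.+ ℤ.∣ ℚ.↥ p ∣ ℤ.*_) (≡.cong ℤ.+_ (ℕ.*-identityˡ (ℕ.suc d))) ⟩
    ℤ.+ ℤ.∣ ℚ.↥ p ∣ ℤ.* ℤ.+ ℕ.suc d                   ≡⟨ ℤ.pos-* ℤ.∣ ℚ.↥ p ∣ (ℕ.suc d) ⟨
    ℤ.+ (ℤ.∣ ℚ.↥ p ∣ ℕ.* ℕ.suc d)                   <⟨ ℤ.+<+ (ℕ.m<n+m _ {ℕ.suc d} ℕ.z<s) ⟩
    ℤ.+ N                                           ≤⟨ ℤ.+≤+ (ℕ.m≤m*n N (ℕ.suc a)) ⟩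
    ℤ.+ (N ℕ.* ℕ.suc a)                             ≤⟨ ℤ.+≤+ (ℕ.m≤m*n _ (ℚ.↧ₙ p)) ⟩
    ℤ.+ (N ℕ.* ℕ.suc a ℕ.* ℚ.↧ₙ p)                  ≡⟨ ℤ.pos-* (N ℕ.* ℕ.suc a) (ℚ.↧ₙ p) ⟩
    ℤ.+ (N ℕ.* ℕ.suc a) ℤ.* ℚ.↧ p                   ≡⟨ ≡.cong (ℤ._* ℚ.↧ p) (ℤ.pos-* N (ℕ.suc a)) ⟩
    ℤ.+ N ℤ.* ℤ.+ ℕ.suc a ℤ.* ℚ.↧ p                   ∎)))
  where
  open ℤ.≤-Reasoning
  -- As `q` is at least `1 / suc d`, the product `ι N ℚ.* q` is at least one more than the absolute
  -- numerator of `p`, which bounds `p`.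
  N = ℕ.suc ℤ.∣ ℚ.↥ p ∣ ℕ.* ℕ.suc d
  z≤+∣z∣ : ∀ z → z ℤ.≤ ℤ.+ ℤ.∣ z ∣
  z≤+∣z∣ (ℤ.+ n)      = ℤ.≤-refl
  z≤+∣z∣ ℤ.-[1+ n ] = ℤ.-≤+

n≤2^n : ∀ n → n ℕ.≤ 2 ℕ.^ n
n≤2^n ℕ.zero    = ℕ.z≤n
n≤2^n (ℕ.suc n) = ℕ.≤-trans (ℕ.+-mono-≤ (ℕ.m^n>0 2 n) (n≤2^n n))
  (ℕ.≤-reflexive (≡.cong (2 ℕ.^ n ℕ.+_) (≡.sym (ℕ.+-identityʳ _))))

halve-ι : ∀ n p → ι (2 ℕ.^ n) ℚ.* halve n p ≡ p
halve-ι ℕ.zero    p = ℚ.*-identityˡ p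
halve-ι (ℕ.suc n) p = ≡.trans (≡.cong (ℚ._* halve (ℕ.suc n) p)
    (≡.trans (≡.cong (λ k → ι (2 ℕ.^ n ℕ.+ k)) (ℕ.+-identityʳ (2 ℕ.^ n)))
      (ι-+ (2 ℕ.^ n) (2 ℕ.^ n))))
  (≡.trans (solve 2 (λ t h → (t :+ t) :* (con ½ :* h) := t :* h) refl (ι (2 ℕ.^ n)) (halve n p))
    (halve-ι n p))

halve-small : ∀ p {q} → 0ℚ < q → ∃[ N ] ∀ n → N ℕ.≤ n → halve n p < q
halve-small p {q} 0<q with archimedean p 0<q
... | N , p<Nq = N , λ n N≤n → ℚ.≰⇒> λ q≤h → ℚ.<-irrefl refl (begin-strict
  p                          <⟨ p<Nq ⟩
  ι N ℚ.* q                  ≤⟨ ℚ.*-monoʳ-≤-nonNeg q {{ℚ.pos⇒nonNeg q {{ℚ.positive 0<q}}}} (ι-mono (ℕ.≤-trans N≤n (n≤2^n n))) ⟩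
  ι (2 ℕ.^ n) ℚ.* q          ≤⟨ ℚ.*-monoˡ-≤-nonNeg (ι (2 ℕ.^ n)) q≤h ⟩
  ι (2 ℕ.^ n) ℚ.* halve n p  ≡⟨ halve-ι n p ⟩
  p                          ∎)
  where
  open ℚ.≤-Reasoning
  ι-mono : ∀ {m n} → m ℕ.≤ n → ι m ℚ.≤ ι n
  ι-mono m≤n = ℚ.*≤* (ℤ.*-monoʳ-≤-nonNeg (ℤ.+ 1) (ℤ.+≤+ m≤n))

-- Cotransitivity replaces decidability of the order, so that this applies to ℝ as well as to ℚ.
module Between {A : Set} (_≺_ : A → A → Set)
  (trans : ∀ {x y z} → x ≺ y → y ≺ z → x ≺ z)
  (cotrans : ∀ {x y} → x ≺ y → ∀ z → x ≺ z ⊎ z ≺ y)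
  (dense : ∀ {x y} → x ≺ y → ∃[ z ] x ≺ z × z ≺ y)
  (above : ∀ x → ∃[ y ] x ≺ y) (below : ∀ x → ∃[ y ] y ≺ x) (point : A)
  where

  belowAll : ∀ us → ∃[ z ] All (z ≺_) us
  belowAll []       = point , []
  belowAll (u ∷ us) with belowAll us | below u
  ... | z , z≺us | v , v≺u with cotrans v≺u z
  ...   | inj₁ v≺z = v , v≺u ∷ All.map (trans v≺z) z≺us
  ...   | inj₂ z≺u = z , z≺u ∷ z≺us

  betweenOne : ∀ {l} us → All (l ≺_) us → ∃[ z ] l ≺ z × All (z ≺_) us
  betweenOne {l} [] [] = let z , l≺z = above l in z , l≺z , []
  betweenOne (u ∷ us) (l≺u ∷ l≺us) with betweenOne us l≺us | dense l≺u
  ... | z , l≺z , z≺us | v , l≺v , v≺u with cotrans v≺u z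
  ...   | inj₁ v≺z = v , l≺v , v≺u ∷ All.map (trans v≺z) z≺us
  ...   | inj₂ z≺u = z , l≺z , z≺u ∷ z≺us

  -- There is no decidable maximum to take. Instead `z` is above `ls`, `v` is above `l`, and
  -- cotransitivity of `l ≺ v` at `z` tells which of the two is above all of them; both are below
  -- `us`.
  between : ∀ ls us → All (λ l → All (l ≺_) us) ls → ∃[ z ] All (_≺ z) ls × All (z ≺_) us
  between [] us [] = let z , z≺us = belowAll us in z , [] , z≺us
  between (l ∷ ls) us (l≺us ∷ ls≺us) with between ls us ls≺us
  ... | z , ls≺z , z≺us with betweenOne us l≺us
  ...   | v , l≺v , v≺us with cotrans l≺v z
  ...     | inj₁ l≺z = z , l≺z ∷ ls≺z , z≺us
  ...     | inj₂ z≺v = v , l≺v ∷ All.map (λ l≺z → trans l≺z z≺v) ls≺z , v≺us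

ℚ-cotrans : ∀ {x y} → x < y → ∀ z → x < z ⊎ z < y
ℚ-cotrans {x} {y} x<y z with x ℚ.<? z
... | yes x<z = inj₁ x<z
... | no  x≮z = inj₂ (ℚ.≤-<-trans (ℚ.≮⇒≥ x≮z) x<y)

open Between _<_ ℚ.<-trans ℚ-cotrans ℚ.<-dense
  (λ x → x + 1ℚ , p<p+e x 0<1) (λ x → x - 1ℚ , p-e<p x 0<1) 0ℚ

-- Each forbidden `c` costs one subdivision: for a point `m` inside the interval, `c` misses the
-- part below `m` or the part above it.
avoid : ∀ {a b} → a < b → ∀ cs → ∃[ y ] a < y × y < b × All (y ≢_) cs
avoid a<b [] = let y , a<y , y<b = ℚ.<-dense a<b in y , a<y , y<b , []
avoid {a} {b} a<b (c ∷ cs) with ℚ.<-dense a<b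
... | m , a<m , m<b with m ℚ.<? c
...   | yes m<c = let y , a<y , y<m , y≢cs = avoid a<m cs in
        y , a<y , ℚ.<-trans y<m m<b , ℚ.<⇒≢ (ℚ.<-trans y<m m<c) ∷ y≢cs
...   | no  m≮c = let y , m<y , y<b , y≢cs = avoid m<b cs in
        y , ℚ.<-trans a<m m<y , y<b
          , (λ y≡c → ℚ.<⇒≢ (ℚ.≤-<-trans (ℚ.≮⇒≥ m≮c) m<y) (≡.sym y≡c)) ∷ y≢cs

-- Fourier–Motzkin elimination

Point Form : ℕ → Set
Point n = Fin n → ℚ
Form n = Fin n → ℚ

dot : Form n → Point n → ℚ
dot {ℕ.zero}  a x = 0ℚ
dot {ℕ.suc n} a x = a zero ℚ.* x zero + dot (a ∘ suc) (x ∘ suc)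

infixl 6 _⊹_
infixl 7 _⊛_

_⊹_ : Form n → Form n → Form n
(a ⊹ b) i = a i + b i

_⊛_ : ℚ → Form n → Form n
(c ⊛ a) i = c ℚ.* a i

basis : Fin n → Form n
basis zero    zero    = 1ℚ
basis zero    (suc j) = 0ℚ
basis (suc i) zero    = 0ℚ
basis (suc i) (suc j) = basis i j

dot-⊹ : ∀ (a b : Form n) x → dot (a ⊹ b) x ≡ dot a x + dot b x
dot-⊹ {ℕ.zero}  a b x = refl
dot-⊹ {ℕ.suc n} a b x rewrite dot-⊹ (a ∘ suc) (b ∘ suc) (x ∘ suc) =
  solve 5 (λ a b t d e → (a :+ b) :* t :+ (d :+ e) := a :* t :+ d :+ (b :* t :+ e)) refl
    (a zero) (b zero) (x zero) (dot (a ∘ suc) (x ∘ suc)) (dot (b ∘ suc) (x ∘ suc))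

dot-⊛ : ∀ c (a : Form n) x → dot (c ⊛ a) x ≡ c ℚ.* dot a x
dot-⊛ {ℕ.zero}  c a x = ≡.sym (ℚ.*-zeroʳ c)
dot-⊛ {ℕ.suc n} c a x rewrite dot-⊛ c (a ∘ suc) (x ∘ suc) =
  solve 4 (λ c a t d → c :* a :* t :+ c :* d := c :* (a :* t :+ d)) refl
    c (a zero) (x zero) (dot (a ∘ suc) (x ∘ suc))

dot-zero : ∀ (x : Point n) → dot (λ _ → 0ℚ) x ≡ 0ℚ
dot-zero {ℕ.zero}  x = refl
dot-zero {ℕ.suc n} x rewrite dot-zero (x ∘ suc) =
  solve 1 (λ t → con 0ℚ :* t :+ con 0ℚ := con 0ℚ) refl (x zero)

dot-basis : ∀ i (x : Point n) → dot (basis i) x ≡ x i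
dot-basis zero    x rewrite dot-zero (x ∘ suc) =
  solve 1 (λ t → con 1ℚ :* t :+ con 0ℚ := t) refl (x zero)
dot-basis (suc i) x rewrite dot-basis i (x ∘ suc) =
  solve 2 (λ t s → con 0ℚ :* t :+ s := s) refl (x zero) (x (suc i))

-- A strict inequality solved for the first coordinate, whose coefficient has been scaled to 1 or
-- -1, or is 0.
data Bound (n : ℕ) : Set where
  lower upper free : Form n → Bound n

Sat : ℚ → Point n → Bound n → Set
Sat t x (lower b) = - dot b x < t
Sat t x (upper b) = t < dot b x
Sat t x (free b)  = 0ℚ < dot b x

reciprocal : ∀ {p} → 0ℚ < p → ∃[ r ] 0ℚ < r × r ℚ.* p ≡ 1ℚ
reciprocal {p} 0<p = r , ℚ.positive⁻¹ r {{ℚ.1/pos⇒pos p}} , ℚ.*-inverseˡ p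
  where
  instance
    p-pos : ℚ.Positive p
    p-pos = ℚ.positive 0<p
    p-nonZero : ℚ.NonZero p
    p-nonZero = ℚ.pos⇒nonZero p
  r = ℚ.1/ p

scale-pos : ∀ {r p} → 0ℚ < r → 0ℚ < p → 0ℚ < r ℚ.* p
scale-pos {r} {p} 0<r 0<p = ≡.subst (_< r ℚ.* p) (ℚ.*-zeroʳ r)
  (ℚ.*-monoʳ-<-pos r {{ℚ.positive 0<r}} 0<p)

scale-pos⁻ : ∀ {r p} → 0ℚ < r → 0ℚ < r ℚ.* p → 0ℚ < p
scale-pos⁻ {r} {p} 0<r 0<rp =
  ℚ.*-cancelˡ-<-nonNeg r {{ℚ.pos⇒nonNeg r {{ℚ.positive 0<r}}}}
    (≡.subst (_< r ℚ.* p) (≡.sym (ℚ.*-zeroʳ r)) 0<rp)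

toBound : ∀ (a : Form (ℕ.suc n)) → ∃[ B ] ∀ x →
  (0ℚ < dot a x → Sat (x zero) (x ∘ suc) B) × (Sat (x zero) (x ∘ suc) B → 0ℚ < dot a x)
toBound a with ℚ.<-cmp 0ℚ (a zero)
... | tri≈ _ 0≡a₀ _ = free (a ∘ suc) , λ x →
  let eq : dot a x ≡ dot (a ∘ suc) (x ∘ suc)
      eq = ≡.trans (≡.cong (λ p → p ℚ.* x zero + dot (a ∘ suc) (x ∘ suc)) (≡.sym 0≡a₀))
             (solve 2 (λ t d → con 0ℚ :* t :+ d := d) refl (x zero) (dot (a ∘ suc) (x ∘ suc)))
  in ≡.subst (0ℚ <_) eq , ≡.subst (0ℚ <_) (≡.sym eq)
... | tri< 0<a₀ _ _ = let r , 0<r , ra₀≡1 = reciprocal 0<a₀ in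
  lower (r ⊛ (a ∘ suc)) , λ x →
  let t = x zero
      d = dot (a ∘ suc) (x ∘ suc)
      D = dot (r ⊛ (a ∘ suc)) (x ∘ suc)
      eq : r ℚ.* dot a x ≡ t + D
      eq = ≡.trans (solve 4 (λ r a₀ t d → r :* (a₀ :* t :+ d) := r :* a₀ :* t :+ r :* d) refl r
          (a zero) t d)
             (≡.cong₂ _+_ (≡.trans (≡.cong (ℚ._* t) ra₀≡1) (ℚ.*-identityˡ t))
               (≡.sym (dot-⊛ r (a ∘ suc) (x ∘ suc))))
  in (λ h → shift-< (≡.subst (0ℚ <_) eq (scale-pos 0<r h))
         (solve 2 (λ t D → con 0ℚ :+ t := :- D :+ (t :+ D)) refl t D))
   , (λ h → scale-pos⁻ 0<r (≡.subst (0ℚ <_) (≡.sym eq) (shift-< h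
         (solve 2 (λ t D → :- D :+ (t :+ D) := con 0ℚ :+ t) refl t D))))
... | tri> _ _ a₀<0 = let r , 0<r , -ra₀≡1 = reciprocal (ℚ.neg-antimono-< a₀<0) in
  upper (r ⊛ (a ∘ suc)) , λ x →
  let t = x zero
      d = dot (a ∘ suc) (x ∘ suc)
      D = dot (r ⊛ (a ∘ suc)) (x ∘ suc)
      eq : r ℚ.* dot a x ≡ - t + D
      eq = ≡.trans (solve 4 (λ r a₀ t d → r :* (a₀ :* t :+ d) := :- (r :* (:- a₀) :* t) :+ r :* d)
          refl r (a zero) t d)
             (≡.cong₂ _+_ (≡.cong -_ (≡.trans (≡.cong (ℚ._* t) -ra₀≡1) (ℚ.*-identityˡ t)))
               (≡.sym (dot-⊛ r (a ∘ suc) (x ∘ suc))))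
  in (λ h → shift-< (≡.subst (0ℚ <_) eq (scale-pos 0<r h))
         (solve 2 (λ t D → con 0ℚ :+ D := t :+ (:- t :+ D)) refl t D))
   , (λ h → scale-pos⁻ 0<r (≡.subst (0ℚ <_) (≡.sym eq) (shift-< h
         (solve 2 (λ t D → t :+ (:- t :+ D) := con 0ℚ :+ D) refl t D))))

lowers uppers frees : List (Bound n) → List (Form n)
lowers []             = []
lowers (lower b ∷ Bs) = b ∷ lowers Bs
lowers (upper b ∷ Bs) = lowers Bs
lowers (free b  ∷ Bs) = lowers Bs
uppers []             = []
uppers (lower b ∷ Bs) = uppers Bs
uppers (upper b ∷ Bs) = b ∷ uppers Bs
uppers (free b  ∷ Bs) = uppers Bs
frees  []             = []
frees  (lower b ∷ Bs) = frees Bs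
frees  (upper b ∷ Bs) = frees Bs
frees  (free b  ∷ Bs) = b ∷ frees Bs

module _ {t : ℚ} {x : Point n} where

  satAll⁺ : ∀ Bs → All (λ b → - dot b x < t) (lowers Bs) → All (λ b → t < dot b x) (uppers Bs) →
            All (λ b → 0ℚ < dot b x) (frees Bs) → All (Sat t x) Bs
  satAll⁺ []             _        _        _        = []
  satAll⁺ (lower b ∷ Bs) (h ∷ ls) us       fs       = h ∷ satAll⁺ Bs ls us fs
  satAll⁺ (upper b ∷ Bs) ls       (h ∷ us) fs       = h ∷ satAll⁺ Bs ls us fs
  satAll⁺ (free b  ∷ Bs) ls       us       (h ∷ fs) = h ∷ satAll⁺ Bs ls us fs

  satAll⁻ : ∀ Bs → All (Sat t x) Bs → All (λ b → - dot b x < t) (lowers Bs) ×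
            All (λ b → t < dot b x) (uppers Bs) × All (λ b → 0ℚ < dot b x) (frees Bs)
  satAll⁻ []             []       = [] , [] , []
  satAll⁻ (lower b ∷ Bs) (h ∷ hs) = let ls , us , fs = satAll⁻ Bs hs in h ∷ ls , us , fs
  satAll⁻ (upper b ∷ Bs) (h ∷ hs) = let ls , us , fs = satAll⁻ Bs hs in ls , h ∷ us , fs
  satAll⁻ (free b  ∷ Bs) (h ∷ hs) = let ls , us , fs = satAll⁻ Bs hs in ls , us , h ∷ fs

_⊨_ : Point n → List (Form n) → Set
x ⊨ L = All (λ a → 0ℚ < dot a x) L

bounds : List (Form (ℕ.suc n)) → List (Bound n)
bounds = map (λ a → proj₁ (toBound a))

-- Since a lower bound is stored with the opposite sign, positivity of `l ⊹ u` says that the lower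
-- bound lies below the upper one.
eliminate : List (Bound n) → List (Form n)
eliminate Bs = frees Bs ++ cartesianProductWith _⊹_ (lowers Bs) (uppers Bs)

eliminate-sound : ∀ (Bs : List (Bound n)) {x} → x ⊨ eliminate Bs → ∃[ t ] All (Sat t x) Bs
eliminate-sound Bs {x} x⊨ =
  let t , ls<t , t<us = between (map (λ b → - dot b x) (lowers Bs)) (map (λ b → dot b x) (uppers Bs))
        (All.map⁺ (All.tabulate λ {l} l∈ → All.map⁺ (All.tabulate λ {u} u∈ →
          shift-< (≡.subst (0ℚ <_) (dot-⊹ l u x)
              (All.lookup (All.++⁻ʳ (frees Bs) x⊨) (Membership.∈-cartesianProductWith⁺ _⊹_ l∈ u∈)))
            (solve 2 (λ l u → con 0ℚ :+ u := :- l :+ (l :+ u)) refl (dot l x) (dot u x)))))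
  in t , satAll⁺ Bs (All.map⁻ ls<t) (All.map⁻ t<us) (All.++⁻ˡ (frees Bs) x⊨)

eliminate-complete : ∀ (Bs : List (Bound n)) {t x} → All (Sat t x) Bs → x ⊨ eliminate Bs
eliminate-complete Bs {t} {x} sat =
  let ls , us , fs = satAll⁻ Bs sat in
  All.++⁺ fs (All.tabulate λ {f} f∈ →
    let l , u , l∈ , u∈ , f≡ = Membership.∈-cartesianProductWith⁻ _⊹_ (lowers Bs) (uppers Bs) f∈ in
    ≡.subst (0ℚ <_) (≡.trans (≡.sym (dot-⊹ l u x)) (≡.cong (λ g → dot g x) (≡.sym f≡)))
      (shift-< (ℚ.<-trans (All.lookup ls l∈) (All.lookup us u∈))
        (solve 2 (λ l u → :- l :+ (l :+ u) := con 0ℚ :+ u) refl (dot l x) (dot u x))))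

feasible? : ∀ (L : List (Form n)) → Dec (∃[ x ] x ⊨ L)
feasible? {ℕ.zero}  []      = yes ((λ ()) , [])
-- A form in no variables has the value 0, so a single strict constraint is already infeasible.
feasible? {ℕ.zero}  (_ ∷ _) = no λ { (_ , 0<0 ∷ _) → ℚ.<-irrefl refl 0<0 }
feasible? {ℕ.suc n} L       = map′
  (λ (x , x⊨) → let t , sat = eliminate-sound (bounds L) x⊨ in
    t Vector.∷ x , All.map (λ {a} → proj₂ (proj₂ (toBound a) (t Vector.∷ x))) (All.map⁻ sat))
  (λ (x , x⊨) → x ∘ suc , eliminate-complete (bounds L)
    (All.map⁺ (All.map (λ {a} → proj₁ (proj₂ (toBound a) x)) x⊨)))
  (feasible? (eliminate (bounds L)))

-- One solution for each feasible choice of signs of the forms in F, subject to the constraints L.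
representatives : (F L : List (Form n)) → List (Point n)
representatives [] L with feasible? L
... | yes (x , _) = x ∷ []
... | no _        = []
representatives (f ∷ F) L = representatives F (f ∷ L) ++ representatives F (- 1ℚ ⊛ f ∷ L)

-- Transporting positive signs is enough for the intended `F`: the list of differences contains the
-- negative of each of its forms, up to equality of values, by exchanging the two pairs.
representatives-cover : ∀ F L {q : Point n} → q ⊨ L → All (λ f → dot f q ≢ 0ℚ) F →
  Any (λ x → x ⊨ L × All (λ f → 0ℚ < dot f q → 0ℚ < dot f x) F) (representatives F L)
representatives-cover [] L {q} q⊨L [] with feasible? L
... | yes (x , x⊨L) = here (x⊨L , [])
... | no  none      = contradiction (q , q⊨L) none
representatives-cover (f ∷ F) L {q} q⊨L (f≢0 ∷ F≢0) with ℚ.<-cmp 0ℚ (dot f q)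
... | tri< 0<f _ _ = Any.++⁺ˡ (Any.map (λ { (0<fx ∷ x⊨L , agree) → x⊨L , (λ _ → 0<fx) ∷ agree })
      (representatives-cover F (f ∷ L) (0<f ∷ q⊨L) F≢0))
... | tri≈ _ 0≡f _ = contradiction (≡.sym 0≡f) f≢0
... | tri> 0≮f _ f<0 = Any.++⁺ʳ (representatives F (f ∷ L))
      (Any.map (λ { (_ ∷ x⊨L , agree) → x⊨L , (λ 0<f → contradiction 0<f 0≮f) ∷ agree })
        (representatives-cover F (- 1ℚ ⊛ f ∷ L) (0<-f ∷ q⊨L) F≢0))
  where
  0<-f : 0ℚ < dot (- 1ℚ ⊛ f) q
  0<-f = shift-< f<0 (≡.trans (≡.cong (dot f q +_) (dot-⊛ (- 1ℚ) f q))
    (solve 1 (λ d → d :+ con (- 1ℚ) :* d := con 0ℚ :+ con 0ℚ) refl (dot f q)))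

-- Sorting

perm-injective : (π : Permutation′ n) → Injective _≡_ _≡_ (π ⟨$⟩ʳ_)
perm-injective π eq = ≡.trans (≡.sym (Perm.inverseˡ π)) (≡.trans (≡.cong (π ⟨$⟩ˡ_) eq) (Perm.inverseˡ π))

argmin : (f : Point (ℕ.suc n)) → ∃[ k ] ∀ j → f k ℚ.≤ f j
argmin {ℕ.zero}  f = zero , λ { zero → ℚ.≤-refl }
argmin {ℕ.suc n} f with argmin (f ∘ suc)
... | k , f[k]≤ with ℚ.≤-total (f zero) (f (suc k))
...   | inj₁ f₀≤ = zero , λ { zero → ℚ.≤-refl ; (suc j) → ℚ.≤-trans f₀≤ (f[k]≤ j) }
...   | inj₂ ≤f₀ = suc k , λ { zero → ≤f₀ ; (suc j) → f[k]≤ j }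

Sorted : Point n → (Fin n → Fin n) → Set
Sorted f σ = ∀ a b → a Fin.< b → f (σ a) < f (σ b)

abstract
  sort : (f : Point n) → Injective _≡_ _≡_ f → ∃ λ (σ : Permutation′ n) → Sorted f (σ ⟨$⟩ʳ_)
  sort {ℕ.zero}  f f-inj = Perm.id , λ ()
  sort {ℕ.suc n} f f-inj with argmin f
  ... | k , f[k]≤ with sort (f ∘ punchIn k) (Fin.punchIn-injective k _ _ ∘ f-inj)
  ...   | σ , sorted = Perm.insert zero k σ , λ where
      zero    (suc b) _         → ≤∧≢⇒< (f[k]≤ _) (λ eq → Fin.punchInᵢ≢i k _ (≡.sym (f-inj eq)))
      (suc a) (suc b) (ℕ.s<s a<b) → sorted a b a<b

strictMono⇒inflationary : (h : Fin n → Fin n) → (∀ {a b} → a Fin.< b → h a Fin.< h b) → ∀ i →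
    i Fin.≤ h i
strictMono⇒inflationary {ℕ.suc n} h mono = <-weakInduction (λ i → i Fin.≤ h i) ℕ.z≤n
  λ i i≤hi → ℕ.≤-<-trans (≡.subst (ℕ._≤ toℕ (h (inject₁ i))) (Fin.toℕ-inject₁ i) i≤hi)
    (mono (ℕ.≤-reflexive (≡.cong ℕ.suc (Fin.toℕ-inject₁ i))))

reflectsOrder : (π ρ : Permutation′ n) → (∀ {i j} → π ⟨$⟩ʳ i Fin.< π ⟨$⟩ʳ j → ρ ⟨$⟩ʳ i Fin.< ρ ⟨$⟩ʳ j) →
                ∀ {i j} → ρ ⟨$⟩ʳ i Fin.< ρ ⟨$⟩ʳ j → π ⟨$⟩ʳ i Fin.< π ⟨$⟩ʳ j
reflectsOrder π ρ mono {i} {j} ρi<ρj with Fin.<-cmp (π ⟨$⟩ʳ i) (π ⟨$⟩ʳ j)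
... | tri< πi<πj _ _ = πi<πj
... | tri≈ _ eq _    = contradiction (≡.cong (ρ ⟨$⟩ʳ_) (perm-injective π eq)) (Fin.<⇒≢ ρi<ρj)
... | tri> _ _ πj<πi = contradiction (mono πj<πi) (Fin.<-asym ρi<ρj)

-- The map sending `π i` to `ρ i` is strictly increasing on `Fin n`, hence inflationary; so is its
-- inverse, and the two inequalities meet.
sameOrder⇒≈ : (π ρ : Permutation′ n) → (∀ {i j} → π ⟨$⟩ʳ i Fin.< π ⟨$⟩ʳ j → ρ ⟨$⟩ʳ i Fin.< ρ ⟨$⟩ʳ j) →
              π Perm.≈ ρ
sameOrder⇒≈ {n} π ρ mono i = Fin.≤-antisym (below π ρ mono i) (below ρ π (reflectsOrder π ρ mono) i)
  where
  below : (π ρ : Permutation′ n) → (∀ {i j} → π ⟨$⟩ʳ i Fin.< π ⟨$⟩ʳ j → ρ ⟨$⟩ʳ i Fin.< ρ ⟨$⟩ʳ j) →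
          ∀ i → π ⟨$⟩ʳ i Fin.≤ ρ ⟨$⟩ʳ i
  below π ρ mono i = ≡.subst (λ k → π ⟨$⟩ʳ i Fin.≤ ρ ⟨$⟩ʳ k) (Perm.inverseˡ π)
    (strictMono⇒inflationary (λ a → ρ ⟨$⟩ʳ (π ⟨$⟩ˡ a))
      (λ a<b → mono (≡.subst₂ Fin._<_ (≡.sym (Perm.inverseʳ π)) (≡.sym (Perm.inverseʳ π)) a<b)) (π ⟨$⟩ʳ i))

opposite-< : ∀ {i j : Fin n} → i Fin.< j → opposite j Fin.< opposite i
opposite-< {n} {i} {j} i<j = ≡.subst₂ ℕ._<_ (≡.sym (Fin.opposite-prop j))
    (≡.sym (Fin.opposite-prop i))
  (ℕ.∸-monoʳ-< (ℕ.s<s i<j) (Fin.toℕ<n j))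

-- Configurations

SamePair : (i j k l : Fin n) → Set
SamePair i j k l = (i ≡ k × j ≡ l) ⊎ (i ≡ l × j ≡ k)

samePair? : (i j k l : Fin n) → Dec (SamePair i j k l)
samePair? i j k l = (i Fin.≟ k ×-dec j Fin.≟ l) ⊎-dec (i Fin.≟ l ×-dec j Fin.≟ k)

record GenericQ (q : Point n) : Set where
  constructor mkGeneric
  field distinct : ∀ {i j k l} → i ≢ j → k ≢ l → ¬ SamePair i j k l → q i + q j ≢ q k + q l

open GenericQ

infix 4 _∼_
record _∼_ (q r : Point n) : Set where
  constructor mk∼
  field preserve : ∀ {i j k l} → i ≢ j → k ≢ l → q i + q j < q k + q l → r i + r j < r k + r l

open _∼_

data PairOrder (q : Point n) (i j k l : Fin n) : Set where
  same : q i + q j ≡ q k + q l → SamePair i j k l → PairOrder q i j k l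
  less : q i + q j < q k + q l → PairOrder q i j k l
  more : q k + q l < q i + q j → PairOrder q i j k l

samePair⇒≡ : (q : Point n) → ∀ {i j k l} → SamePair i j k l → q i + q j ≡ q k + q l
samePair⇒≡ q (inj₁ (refl , refl))             = refl
samePair⇒≡ q {i} {j} (inj₂ (refl , refl)) = ℚ.+-comm (q i) (q j)

pairOrder : {q : Point n} → GenericQ q → ∀ {i j k l} → i ≢ j → k ≢ l → PairOrder q i j k l
pairOrder {q = q} gen {i} {j} {k} {l} i≢j k≢l with ℚ.<-cmp (q i + q j) (q k + q l) | samePair? i j
    k l
... | tri< lt _ _ | _     = less lt
... | tri> _ _ gt | _     = more gt
... | tri≈ _ eq _ | yes s = same eq s
... | tri≈ _ eq _ | no ¬s = contradiction eq (distinct gen i≢j k≢l ¬s)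

∼-trans : {q r s : Point n} → q ∼ r → r ∼ s → q ∼ s
∼-trans q∼r r∼s = mk∼ λ i≢j k≢l → preserve r∼s i≢j k≢l ∘ preserve q∼r i≢j k≢l

-- Genericity makes the order of pair sums in `q` total apart from coinciding pairs, and a map
-- preserving a total strict order reflects it.
∼-sym : {q r : Point n} → GenericQ q → q ∼ r → r ∼ q
∼-sym {q = q} {r} gen q∼r = mk∼ back
  where
  back : ∀ {i j k l} → i ≢ j → k ≢ l → r i + r j < r k + r l → q i + q j < q k + q l
  back i≢j k≢l lt with pairOrder gen i≢j k≢l
  ... | same _ s  = contradiction (samePair⇒≡ r s) (ℚ.<⇒≢ lt)
  ... | less lt′  = lt′
  ... | more gt   = contradiction (preserve q∼r k≢l i≢j gt) (ℚ.<-asym lt)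

≗⇒∼ : {q r : Point n} → (∀ i → q i ≡ r i) → q ∼ r
≗⇒∼ q≗r = mk∼ λ {i} {j} {k} {l} _ _ →
  ≡.subst₂ _<_ (≡.cong₂ _+_ (q≗r i) (q≗r j)) (≡.cong₂ _+_ (q≗r k) (q≗r l))

neg : Point n → Point n
neg q i = - q i

neg-flip : ∀ a b c d → - a + - b < - c + - d → c + d < a + b
neg-flip a b c d h = shift-< h (solve 4 (λ a b c d → :- a :+ :- b :+ (a :+ b) :=
    c :+ d :+ (:- c :+ :- d)) refl a b c d)

neg-flip⁺ : ∀ a b c d → c + d < a + b → - a + - b < - c + - d
neg-flip⁺ a b c d h = shift-< h (solve 4 (λ a b c d → c :+ d :+ (:- c :+ :- d) :=
    :- a :+ :- b :+ (a :+ b)) refl a b c d)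

neg-cong : {q r : Point n} → q ∼ r → neg q ∼ neg r
neg-cong {q = q} {r} q∼r = mk∼ λ {i} {j} {k} {l} i≢j k≢l lt →
  neg-flip⁺ (r i) (r j) (r k) (r l) (preserve q∼r k≢l i≢j (neg-flip (q i) (q j) (q k) (q l) lt))

neg-involutive : (q : Point n) → neg (neg q) ∼ q
neg-involutive q = ≗⇒∼ λ i → solve 1 (λ a → :- :- a := a) refl (q i)

neg-involutive⁻ : (q : Point n) → q ∼ neg (neg q)
neg-involutive⁻ q = ≗⇒∼ λ i → solve 1 (λ a → a := :- :- a) refl (q i)

neg-generic : {q : Point n} → GenericQ q → GenericQ (neg q)
neg-generic {q = q} gen = mkGeneric λ {i} {j} {k} {l} i≢j k≢l ¬s eq → distinct gen i≢j k≢l ¬s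
  (ℚ.neg-injective (≡.trans (ℚ.neg-distrib-+ (q i) (q j))
    (≡.trans eq (≡.sym (ℚ.neg-distrib-+ (q k) (q l))))))

perm-generic : {q : Point n} (π : Permutation′ n) → GenericQ q → GenericQ (q ∘ (π ⟨$⟩ʳ_))
perm-generic π gen = mkGeneric λ i≢j k≢l ¬s → distinct gen (i≢j ∘ inj) (k≢l ∘ inj)
  λ { (inj₁ (p , q)) → ¬s (inj₁ (inj p , inj q)) ; (inj₂ (p , q)) → ¬s (inj₂ (inj p , inj q)) }
  where
  inj : Injective _≡_ _≡_ (π ⟨$⟩ʳ_)
  inj = perm-injective π

perm-cong : {q r : Point n} (π : Permutation′ n) → q ∼ r → (q ∘ (π ⟨$⟩ʳ_)) ∼ (r ∘ (π ⟨$⟩ʳ_))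
perm-cong π q∼r = mk∼ λ i≢j k≢l → preserve q∼r (i≢j ∘ perm-injective π) (k≢l ∘ perm-injective π)

-- This is where `m ≥ 3` enters. `_∼_` sees only sums over distinct indices; with a third index `k`,
-- comparing `q k + q i` with `q k + q j` compares the coordinates `q i` and `q j`.
third : (i j : Fin (3 ℕ.+ n)) → ∃[ k ] k ≢ i × k ≢ j
third zero          zero          = suc zero , (λ ()) , (λ ())
third zero          (suc zero)    = suc (suc zero) , (λ ()) , (λ ())
third zero          (suc (suc _)) = suc zero , (λ ()) , (λ ())
third (suc zero)    zero          = suc (suc zero) , (λ ()) , (λ ())
third (suc (suc _)) zero          = suc zero , (λ ()) , (λ ())
third (suc _)       (suc _)       = zero , (λ ()) , (λ ())

+-cancelˡ-< : ∀ a {b c} → a + b < a + c → b < c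
+-cancelˡ-< a {b} {c} h = shift-< h (solve 3 (λ a b c → a :+ b :+ c := b :+ (a :+ c)) refl a b c)

∼⇒order : {q r : Point (3 ℕ.+ n)} → q ∼ r → ∀ {i j} → q i < q j → r i < r j
∼⇒order {q = q} {r} q∼r {i} {j} qi<qj = let k , k≢i , k≢j = third i j in
  +-cancelˡ-< (r k) (preserve q∼r k≢i k≢j (ℚ.+-monoʳ-< (q k) qi<qj))

generic⇒injective : {q : Point (3 ℕ.+ n)} → GenericQ q → Injective _≡_ _≡_ q
generic⇒injective {q = q} gen {i} {j} qi≡qj with i Fin.≟ j
... | yes i≡j = i≡j
... | no  i≢j = let k , k≢i , k≢j = third i j in
  contradiction (≡.cong (q k +_) qi≡qj)
    (distinct gen k≢i k≢j λ { (inj₁ (_ , i≡j)) → i≢j i≡j ; (inj₂ (k≡j , _)) → k≢j k≡j })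

-- Admitted rankings

-- The y with the ranking σ are those lying above all midpoints of descents and below all
-- midpoints of ascents, so they exist when the former midpoints are below the latter.
record Admits (q : Point n) (σ : Fin n → Fin n) : Set where
  constructor mkAdmits
  field
    separated : ∀ {a b c d} → a Fin.< b → c Fin.< d → q (σ b) < q (σ a) → q (σ c) < q (σ d) →
                q (σ a) + q (σ b) < q (σ c) + q (σ d)

open Admits

ranked⇒admits : (q : Point n) (σ : Fin n → Fin n) (y : ℚ) →
  (∀ a b → a Fin.< b → ∣ y - q (σ a) ∣ < ∣ y - q (σ b) ∣) → Admits q σ
ranked⇒admits q σ y ranked = mkAdmits λ {a} {b} {c} {d} a<b c<d desc asc →
  ℚ.<-trans (distance⁻-> {y} desc (ranked a b a<b)) (distance⁻-< {y} asc (ranked c d c<d))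

order-≢ : (q : Point n) → ∀ {i j} → q i < q j → i ≢ j
order-≢ q qi<qj refl = ℚ.<-irrefl refl qi<qj

admits-cong : {q r : Point (3 ℕ.+ n)} → GenericQ q → q ∼ r → ∀ {σ} → Admits q σ → Admits r σ
admits-cong {q = q} {r} gen q∼r adm = mkAdmits λ a<b c<d desc asc →
  preserve q∼r (order-≢ r desc ∘ ≡.sym) (order-≢ r asc)
    (separated adm a<b c<d (∼⇒order (∼-sym gen q∼r) desc) (∼⇒order (∼-sym gen q∼r) asc))

neg-order : ∀ {a b} → - a < - b → b < a
neg-order {a} {b} h = shift-< h (solve 2 (λ a b → :- a :+ a := b :+ :- b) refl a b)

-- Reflection exchanges ascents with descents and reverses the order of midpoints, so the condition
-- is carried to itself with its two pairs swapped.
admits-neg : (q : Point n) → ∀ {σ} → Admits q σ → Admits (neg q) σ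
admits-neg q {σ} adm = mkAdmits λ {a} {b} {c} {d} a<b c<d desc asc →
  neg-flip⁺ (q (σ a)) (q (σ b)) (q (σ c)) (q (σ d))
      (separated adm c<d a<b (neg-order asc) (neg-order desc))

-- Recovering a configuration from its rankings

SameRankings : Point n → Point n → Set
SameRankings {n} q r = ∀ (π : Permutation′ n) → Admits q (π ⟨$⟩ʳ_) → Admits r (π ⟨$⟩ʳ_)

sorted-reflects : {f : Point n} {σ : Fin n → Fin n} → Sorted f σ → ∀ {a b} → f (σ a) < f (σ b) →
    a Fin.< b
sorted-reflects {f = f} sorted {a} {b} lt with Fin.<-cmp a b
... | tri< a<b _ _  = a<b
... | tri≈ _ refl _ = contradiction lt (ℚ.<-irrefl refl)
... | tri> _ _ b<a  = contradiction (sorted b a b<a) (ℚ.<-asym lt)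

-- A midpoint order is witnessed by a ranking realised by a point strictly between the two.
midpointOrder : {q r : Point (3 ℕ.+ n)} → GenericQ q → SameRankings q r →
  (∀ {i j} → q i < q j → r i < r j) → ∀ {i j k l} → q i < q j → q k < q l → q i + q j < q k + q l →
    r i + r j < r k + r l
midpointOrder {n} {q} {r} gen incl order {i} {j} {k} {l} qi<qj qk<ql lt
  -- Off all midpoints the distances to `y` are pairwise distinct, so that sorting by distance
  -- yields a permutation.
  with avoid (ℚ.*-monoʳ-<-pos ½ lt) (cartesianProductWith (λ a b → ½ ℚ.* (q a + q b)) (allFin _)
      (allFin _))
... | y , ij<y , y<kl , y∉mids = ≡.subst₂ _<_ (ℚ.+-comm (r j) (r i)) refl
    (≡.subst₂ _<_ (≡.cong₂ _+_ (rπ j) (rπ i)) (≡.cong₂ _+_ (rπ k) (rπ l))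
      -- As `y` is past the midpoint of `i` and `j`, the ranking puts `j` before `i`, a descent; as
      -- it is short of the midpoint of `k` and `l`, it puts `k` before `l`, an ascent.
      (separated (incl π (ranked⇒admits q (π ⟨$⟩ʳ_) y sorted))
        (before (closer-> {y} qi<qj (≡.subst (_< y + y) (ℚ.+-comm (q i) (q j)) (½<⇒<double ij<y))))
        (before (closer-< {y} qk<ql (<½⇒double< y<kl)))
        (≡.subst₂ _<_ (≡.sym (rπ i)) (≡.sym (rπ j)) (order qi<qj))
        (≡.subst₂ _<_ (≡.sym (rπ k)) (≡.sym (rπ l)) (order qk<ql))))
  where
  dist : Point (3 ℕ.+ n)
  dist a = ∣ y - q a ∣
  dist-inj : Injective _≡_ _≡_ dist
  dist-inj {a} {b} eq with equidistant y (q a) (q b) eq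
  ... | inj₁ qa≡qb = generic⇒injective gen qa≡qb
  ... | inj₂ y≡mid = contradiction y≡mid (All.lookup y∉mids
        (Membership.∈-cartesianProductWith⁺ _ (Membership.∈-allFin a) (Membership.∈-allFin b)))
  π : Permutation′ (3 ℕ.+ n)
  π = proj₁ (sort dist dist-inj)
  sorted : Sorted dist (π ⟨$⟩ʳ_)
  sorted = proj₂ (sort dist dist-inj)
  π⁻¹ : Fin (3 ℕ.+ n) → Fin (3 ℕ.+ n)
  π⁻¹ = π ⟨$⟩ˡ_
  rπ : ∀ a → r (π ⟨$⟩ʳ π⁻¹ a) ≡ r a
  rπ a = ≡.cong r (Perm.inverseʳ π)
  before : ∀ {a b} → dist a < dist b → π⁻¹ a Fin.< π⁻¹ b
  before lt = sorted-reflects {f = dist} sorted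
    (≡.subst₂ _<_ (≡.sym (≡.cong dist (Perm.inverseʳ π))) (≡.sym (≡.cong dist (Perm.inverseʳ π)))
      lt)
sameRankings⇒∼ : {q r : Point (3 ℕ.+ n)} → GenericQ q → SameRankings q r →
  (∀ {i j} → q i < q j → r i < r j) → q ∼ r
sameRankings⇒∼ {n} {q} {r} gen incl order = mk∼ preserved
  where
  preserved : ∀ {i j k l} → i ≢ j → k ≢ l → q i + q j < q k + q l → r i + r j < r k + r l
  preserved {i} {j} {k} {l} i≢j k≢l lt with ℚ.<-cmp (q i) (q j) | ℚ.<-cmp (q k) (q l)
  ... | tri≈ _ eq _ | _           = contradiction (generic⇒injective gen eq) i≢j
  ... | _           | tri≈ _ eq _ = contradiction (generic⇒injective gen eq) k≢l
  ... | tri< h _ _  | tri< g _ _  = midpointOrder gen incl order h g lt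
  ... | tri< h _ _  | tri> _ _ g  = ≡.subst (r i + r j <_) (ℚ.+-comm (r l) (r k))
        (midpointOrder gen incl order h g (≡.subst (q i + q j <_) (ℚ.+-comm (q k) (q l)) lt))
  ... | tri> _ _ h  | tri< g _ _  = ≡.subst (_< r k + r l) (ℚ.+-comm (r j) (r i))
        (midpointOrder gen incl order h g (≡.subst (_< q k + q l) (ℚ.+-comm (q i) (q j)) lt))
  ... | tri> _ _ h  | tri> _ _ g  = ≡.subst₂ _<_ (ℚ.+-comm (r j) (r i)) (ℚ.+-comm (r l) (r k))
        (midpointOrder gen incl order h g (≡.subst₂ _<_ (ℚ.+-comm (q i) (q j))
          (ℚ.+-comm (q k) (q l)) lt))

-- The increasing ranking of q and its reverse are both admitted by r.
-- If r had both an ascent and a descent along it, these would give opposite inequalities between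
-- two midpoints.
sameRankings⇒order : {q r : Point (3 ℕ.+ n)} → GenericQ q → GenericQ r → SameRankings q r →
  (∀ {i j} → q i < q j → r i < r j) ⊎ (∀ {i j} → q i < q j → r j < r i)
sameRankings⇒order {n} {q} {r} genq genr incl = cases
  where
  π : Permutation′ (3 ℕ.+ n)
  π = proj₁ (sort q (generic⇒injective genq))
  σ σ⁻¹ : Fin (3 ℕ.+ n) → Fin (3 ℕ.+ n)
  σ = π ⟨$⟩ʳ_
  σ⁻¹ = π ⟨$⟩ˡ_
  sorted : Sorted q σ
  sorted = proj₂ (sort q (generic⇒injective genq))
  forwards : Admits r σ
  -- `q` admits this ranking vacuously, as there is no descent along it; the reverse ranking below
  -- has no ascent.
  forwards = incl π (mkAdmits λ {a} {b} a<b _ desc _ →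
      contradiction desc (ℚ.<-asym (sorted a b a<b)))
  backwards : Admits r (σ ∘ opposite)
  backwards = incl (Perm.reverse ∘ₚ π) (mkAdmits λ {_} {_} {c} {d} _ c<d _ asc →
    contradiction asc (ℚ.<-asym (sorted (opposite d) (opposite c) (opposite-< c<d))))
  rσ : ∀ a → r (σ (opposite (opposite a))) ≡ r (σ a)
  rσ a = ≡.cong (r ∘ σ) (Fin.opposite-involutive a)
  noMix : ∀ a b c d → a Fin.< b → c Fin.< d → r (σ b) < r (σ a) → ¬ r (σ c) < r (σ d)
  noMix a b c d a<b c<d desc asc = ℚ.<-asym (separated forwards a<b c<d desc asc)
    (≡.subst₂ _<_
      (≡.trans (≡.cong₂ _+_ (rσ d) (rσ c)) (ℚ.+-comm (r (σ d)) (r (σ c))))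
      (≡.trans (≡.cong₂ _+_ (rσ b) (rσ a)) (ℚ.+-comm (r (σ b)) (r (σ a))))
      (separated backwards (opposite-< c<d) (opposite-< a<b)
        (≡.subst₂ _<_ (≡.sym (rσ c)) (≡.sym (rσ d)) asc)
        (≡.subst₂ _<_ (≡.sym (rσ b)) (≡.sym (rσ a)) desc)))
  σ⁻¹-< : ∀ {i j} → q i < q j → σ⁻¹ i Fin.< σ⁻¹ j
  σ⁻¹-< qi<qj = sorted-reflects {f = q} sorted
    (≡.subst₂ _<_ (≡.sym (≡.cong q (Perm.inverseʳ π))) (≡.sym (≡.cong q (Perm.inverseʳ π))) qi<qj)
  rσσ⁻¹ : ∀ i → r i ≡ r (σ (σ⁻¹ i))
  rσσ⁻¹ i = ≡.cong r (≡.sym (Perm.inverseʳ π))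
  0<1F : Fin._<_ {3 ℕ.+ n} {3 ℕ.+ n} zero (suc zero)
  0<1F = ℕ.z<s
  cases : (∀ {i j} → q i < q j → r i < r j) ⊎ (∀ {i j} → q i < q j → r j < r i)
  -- One comparison decides for all pairs: by `noMix`, an ascent in the first two places excludes
  -- every descent, and a descent there excludes every ascent.
  cases with ℚ.<-cmp (r (σ zero)) (r (σ (suc zero)))
  ... | tri≈ _ eq _ = contradiction (perm-injective π {zero} {suc zero}
      (generic⇒injective genr eq)) λ ()
  ... | tri< asc _ _ = inj₁ λ {i} {j} qi<qj → case (ℚ.<-cmp (r i) (r j)) of λ where
        (tri< lt _ _) → lt
        (tri≈ _ eq _) → contradiction (generic⇒injective genr eq) (order-≢ q qi<qj)
        (tri> _ _ gt) → contradiction asc (noMix (σ⁻¹ i) (σ⁻¹ j) zero (suc zero) (σ⁻¹-< qi<qj) 0<1F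
                          (≡.subst₂ _<_ (rσσ⁻¹ j) (rσσ⁻¹ i) gt))
  ... | tri> _ _ desc = inj₂ λ {i} {j} qi<qj → case (ℚ.<-cmp (r i) (r j)) of λ where
        (tri> _ _ gt) → gt
        (tri≈ _ eq _) → contradiction (generic⇒injective genr eq) (order-≢ q qi<qj)
        (tri< lt _ _) → contradiction (≡.subst₂ _<_ (rσσ⁻¹ i) (rσσ⁻¹ j) lt)
                          (noMix zero (suc zero) (σ⁻¹ i) (σ⁻¹ j) 0<1F (σ⁻¹-< qi<qj) desc)

sameRankings⇒∼⊎∼neg : {q r : Point (3 ℕ.+ n)} → GenericQ q → GenericQ r → SameRankings q r →
  q ∼ r ⊎ q ∼ neg r
sameRankings⇒∼⊎∼neg {r = r} genq genr incl with sameRankings⇒order genq genr incl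
... | inj₁ order = inj₁ (sameRankings⇒∼ genq incl order)
... | inj₂ order = inj₂ (sameRankings⇒∼ genq (λ π → admits-neg r ∘ incl π)
    (ℚ.neg-antimono-< ∘ order))

mkBijection : (S : Setoid ℓ₁ ℓ₂) (T : Setoid ℓ₃ ℓ₄) → let open Setoid in
  (f : Carrier S → Carrier T) → Congruent (_≈_ S) (_≈_ T) f → Injective (_≈_ S) (_≈_ T) f →
  StrictlySurjective (_≈_ T) f → Bijection S T
mkBijection S T f f-cong f-inj f-surj = record
  { to        = f
  ; cong      = f-cong
  ; bijective = f-inj , λ y → let x , fx≈y = f-surj y in x , λ z≈x → Setoid.trans T (f-cong z≈x) fx≈y
  }

-- Finiteness and counting of configurations

∼-refl : {q : Point n} → q ∼ q
∼-refl = mk∼ λ _ _ lt → lt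

_∼?_ : (q r : Point n) → Dec (q ∼ r)
q ∼? r = map′ (λ h → mk∼ λ {i} {j} {k} {l} → h i j k l) (λ q∼r i j k l → preserve q∼r)
  (Fin.all? λ i → Fin.all? λ j → Fin.all? λ k → Fin.all? λ l →
    ¬? (i Fin.≟ j) →-dec ¬? (k Fin.≟ l) →-dec
      (q i + q j ℚ.<? q k + q l) →-dec (r i + r j ℚ.<? r k + r l))

genericQ? : (q : Point n) → Dec (GenericQ q)
genericQ? q = map′ (λ h → mkGeneric λ {i} {j} {k} {l} → h i j k l) (λ gen i j k l → distinct gen)
  (Fin.all? λ i → Fin.all? λ j → Fin.all? λ k → Fin.all? λ l →
    ¬? (i Fin.≟ j) →-dec ¬? (k Fin.≟ l) →-dec ¬? (samePair? i j k l) →-dec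
      ¬? (q i + q j ℚ.≟ q k + q l))

Quad : ℕ → Set
Quad n = (Fin n × Fin n) × (Fin n × Fin n)

quads : ∀ n → List (Quad n)
quads n = cartesianProduct pairs pairs
  where pairs = cartesianProduct (allFin n) (allFin n)

∈-quads : ∀ (i j k l : Fin n) → Any (((i , j) , (k , l)) ≡_) (quads n)
∈-quads i j k l = Membership.∈-cartesianProduct⁺ (pair i j) (pair k l)
  where
  pair : ∀ i j → _
  pair i j = Membership.∈-cartesianProduct⁺ (Membership.∈-allFin i) (Membership.∈-allFin j)

Valid : Quad n → Set
Valid ((i , j) , (k , l)) = i ≢ j × k ≢ l × ¬ SamePair i j k l

valid? : (v : Quad n) → Dec (Valid v)
valid? ((i , j) , (k , l)) = ¬? (i Fin.≟ j) ×-dec ¬? (k Fin.≟ l) ×-dec ¬? (samePair? i j k l)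

difference : Quad n → Form n
difference ((i , j) , (k , l)) = basis k ⊹ basis l ⊹ - 1ℚ ⊛ (basis i ⊹ basis j)

dot-difference : ∀ i j k l (x : Point n) →
  dot (difference ((i , j) , (k , l))) x ≡ x k + x l - (x i + x j)
dot-difference i j k l x
  rewrite dot-⊹ (basis k ⊹ basis l) (- 1ℚ ⊛ (basis i ⊹ basis j)) x
        | dot-⊹ (basis k) (basis l) x
        | dot-⊛ (- 1ℚ) (basis i ⊹ basis j) x
        | dot-⊹ (basis i) (basis j) x
        | dot-basis i x | dot-basis j x | dot-basis k x | dot-basis l x =
  solve 4 (λ i j k l → k :+ l :+ con (- 1ℚ) :* (i :+ j) := k :+ l :- (i :+ j)) refl (x i) (x j)
      (x k) (x l)

diff-pos⁺ : ∀ {p q} → p < q → 0ℚ < q - p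
diff-pos⁺ {p} {q} h = shift-< h (solve 2 (λ p q → p :+ (q :- p) := con 0ℚ :+ q) refl p q)

diff-pos⁻ : ∀ {p q} → 0ℚ < q - p → p < q
diff-pos⁻ {p} {q} h = shift-< h (solve 2 (λ p q → con 0ℚ :+ q := p :+ (q :- p)) refl p q)

diff-≢ : ∀ {p q} → p ≢ q → q - p ≢ 0ℚ
diff-≢ {p} {q} p≢q eq = p≢q (≡.sym (≡.trans (solve 2 (λ p q → q := q :- p :+ p) refl p q)
  (≡.trans (≡.cong (_+ p) eq) (ℚ.+-identityˡ p))))

differences : ∀ n → List (Form n)
differences n = map difference (filter valid? (quads n))

configurations : ∀ n → List (Point n)
configurations n = representatives (differences n) []

configurations-cover : {q : Point n} → GenericQ q →
    Any (λ x → GenericQ x × q ∼ x) (configurations n)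
configurations-cover {n} {q} gen =
  Any.map (λ {x} (_ , agree) → generic agree , mk∼ (preserved agree))
    (representatives-cover (differences n) [] []
      (All.map⁺ (All.tabulate λ {v} v∈ → nonzero v
        (proj₂ (Membership.∈-filter⁻ valid? {xs = quads n} v∈)))))
  where
  nonzero : ∀ v → Valid v → dot (difference v) q ≢ 0ℚ
  nonzero ((i , j) , (k , l)) (i≢j , k≢l , ¬s) eq =
    diff-≢ (distinct gen i≢j k≢l ¬s) (≡.trans (≡.sym (dot-difference i j k l q)) eq)
  Agree : Point n → Set
  Agree x = All (λ f → 0ℚ < dot f q → 0ℚ < dot f x) (differences n)
  preserved : ∀ {x} → Agree x → ∀ {i j k l} → i ≢ j → k ≢ l → q i + q j < q k + q l →
      x i + x j < x k + x l
  preserved {x} agree {i} {j} {k} {l} i≢j k≢l lt =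
      diff-pos⁻ (≡.subst (0ℚ <_) (dot-difference i j k l x)
    (All.lookup agree
      (Membership.∈-map⁺ difference (Membership.∈-filter⁺ valid? (∈-quads i j k l)
        (i≢j , k≢l , λ s → contradiction (samePair⇒≡ q s) (ℚ.<⇒≢ lt))))
      (≡.subst (0ℚ <_) (≡.sym (dot-difference i j k l q)) (diff-pos⁺ lt))))
  generic : ∀ {x} → Agree x → GenericQ x
  generic agree = mkGeneric λ i≢j k≢l ¬s → case pairOrder gen i≢j k≢l of λ where
    (same _ s) → contradiction s ¬s
    (less lt)  → ℚ.<⇒≢ (preserved agree i≢j k≢l lt)
    (more gt)  → ℚ.<⇒≢ (preserved agree k≢l i≢j gt) ∘ ≡.sym

module _ {A : Set} {P : A → Set} (P? : ∀ x → Dec (P x)) where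

  gather : List A → List (Σ A P)
  gather [] = []
  gather (x ∷ xs) with P? x
  ... | yes p = (x , p) ∷ gather xs
  ... | no  _ = gather xs

  gather⁺ : ∀ {Q : A → Set} {xs} → Any (λ x → P x × Q x) xs → Any (Q ∘ proj₁) (gather xs)
  gather⁺ {xs = x ∷ xs} (here (p , qx)) with P? x
  ... | yes _ = here qx
  ... | no ¬p = contradiction p ¬p
  gather⁺ {xs = x ∷ xs} (there h) with P? x
  ... | yes _ = there (gather⁺ h)
  ... | no  _ = gather⁺ h

classes : (P : Point n → Set) → (∀ {q} → P q → GenericQ q) → DecSetoid _ _
classes {n} P P⇒gen = record
  { Carrier = Σ (Point n) P
  ; _≈_ = λ x y → proj₁ x ∼ proj₁ y
  ; isDecEquivalence = record
    { isEquivalence = record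
      { refl = ∼-refl ; sym = λ {x} → ∼-sym (P⇒gen (proj₂ x)) ; trans = ∼-trans }
    ; _≟_ = λ x y → proj₁ x ∼? proj₁ y }
  }

classes-finite : (P : Point n → Set) (P⇒gen : ∀ {q} → P q → GenericQ q) → (∀ q → Dec (P q)) →
  (∀ {q r} → P q → GenericQ r → q ∼ r → P r) →
    ∃[ c ] DecSetoid.setoid (classes P P⇒gen) HasCardinality c
classes-finite {n} P P⇒gen P? P-resp = covered⇒finite (classes P P⇒gen)
    (gather P? (configurations n))
  λ (q , Pq) → gather⁺ P? (Any.map (λ (gen , q∼x) → P-resp Pq gen q∼x , ∼-sym (P⇒gen Pq) q∼x)
    (configurations-cover (P⇒gen Pq)))

Chamber∼ : ℕ → DecSetoid _ _
Chamber∼ n = classes {n} GenericQ id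

chamber∼-finite : ∀ n → ∃[ c ] DecSetoid.setoid (Chamber∼ n) HasCardinality c
chamber∼-finite n = classes-finite GenericQ id genericQ? (λ _ gen _ → gen)

-- Ranking patterns do not distinguish a configuration from its mirror image.
infix 4 _≃_
_≃_ : Point n → Point n → Set
q ≃ r = q ∼ r ⊎ q ∼ neg r

Pattern≃ : ℕ → DecSetoid _ _
Pattern≃ n = record
  { Carrier = Σ (Point n) GenericQ
  ; _≈_ = λ x y → proj₁ x ≃ proj₁ y
  ; isDecEquivalence = record
    { isEquivalence = record
      { refl  = inj₁ ∼-refl
      ; sym   = λ {x} {y} → ≃-sym (proj₂ x) (proj₂ y)
      ; trans = ≃-trans }
    ; _≟_ = λ x y → (proj₁ x ∼? proj₁ y) ⊎-dec (proj₁ x ∼? neg (proj₁ y)) }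
  }
  where
  ≃-sym : {q r : Point n} → GenericQ q → GenericQ r → q ≃ r → r ≃ q
  ≃-sym gen genr (inj₁ q∼r) = inj₁ (∼-sym gen q∼r)
  ≃-sym {r = r} gen genr (inj₂ q∼-r) = inj₂ (∼-trans (neg-involutive⁻ r)
      (neg-cong (∼-sym gen q∼-r)))
  ≃-trans : {q r s : Point n} → q ≃ r → r ≃ s → q ≃ s
  ≃-trans (inj₁ h) (inj₁ k) = inj₁ (∼-trans h k)
  ≃-trans (inj₁ h) (inj₂ k) = inj₂ (∼-trans h k)
  ≃-trans (inj₂ h) (inj₁ k) = inj₂ (∼-trans h (neg-cong k))
  ≃-trans {s = s} (inj₂ h) (inj₂ k) = inj₁ (∼-trans h (∼-trans (neg-cong k) (neg-involutive s)))

pattern≃-finite : ∀ n → ∃[ c ] DecSetoid.setoid (Pattern≃ n) HasCardinality c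
pattern≃-finite n = covered⇒finite (Pattern≃ n) (gather genericQ? (configurations n))
  λ (q , gen) → gather⁺ genericQ? (Any.map (λ (genx , q∼x) → genx , inj₁ (∼-sym gen q∼x))
      (configurations-cover gen))

IncreasingQ : Point n → Set
IncreasingQ q = GenericQ q × Sorted q id

Increasing∼ : ℕ → DecSetoid _ _
Increasing∼ n = classes {n} IncreasingQ proj₁

increasing∼-finite : ∀ n → ∃[ c ] DecSetoid.setoid (Increasing∼ (3 ℕ.+ n)) HasCardinality c
increasing∼-finite n = classes-finite IncreasingQ proj₁
  (λ q → genericQ? q ×-dec (Fin.all? λ i → Fin.all? λ j → (i Fin.<? j) →-dec (q i ℚ.<? q j)))
  (λ (_ , inc) gen q∼r → gen , λ i j i<j → ∼⇒order q∼r (inc i j i<j))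

-- Two chambers for each pattern

side : Point (3 ℕ.+ n) → Fin 2
side q with q zero ℚ.<? q (suc zero)
... | yes _ = zero
... | no _  = suc zero

side-< : {q : Point (3 ℕ.+ n)} → q zero < q (suc zero) → side q ≡ zero
side-< {q = q} lt with q zero ℚ.<? q (suc zero)
... | yes _  = refl
... | no ¬lt = contradiction lt ¬lt

side-> : {q : Point (3 ℕ.+ n)} → q (suc zero) < q zero → side q ≡ suc zero
side-> {q = q} gt with q zero ℚ.<? q (suc zero)
... | yes lt = contradiction gt (ℚ.<-asym lt)
... | no _   = refl

firstTwo : {q : Point (3 ℕ.+ n)} → GenericQ q → q zero < q (suc zero) ⊎ q (suc zero) < q zero
firstTwo {q = q} gen with ℚ.<-cmp (q zero) (q (suc zero))
... | tri< lt _ _ = inj₁ lt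
... | tri≈ _ eq _ = contradiction (generic⇒injective gen {zero} {suc zero} eq) λ ()
... | tri> _ _ gt = inj₂ gt

side-cong : {q r : Point (3 ℕ.+ n)} → GenericQ q → q ∼ r → side q ≡ side r
side-cong gen q∼r with firstTwo gen
... | inj₁ lt = ≡.trans (side-< lt) (≡.sym (side-< (∼⇒order q∼r lt)))
... | inj₂ gt = ≡.trans (side-> gt) (≡.sym (side-> (∼⇒order q∼r gt)))

side-neg : {q : Point (3 ℕ.+ n)} → GenericQ q → side q ≢ side (neg q)
side-neg gen eq with firstTwo gen
... | inj₁ lt = case ≡.trans (≡.sym (side-< lt)) (≡.trans eq (side-> (ℚ.neg-antimono-< lt))) of λ ()
... | inj₂ gt = case ≡.trans (≡.sym (side-> gt)) (≡.trans eq (side-< (ℚ.neg-antimono-< gt))) of λ ()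

two-values : (i j k : Fin 2) → i ≢ j → i ≢ k → j ≡ k
two-values zero       zero       _          i≢j _   = contradiction refl i≢j
two-values zero       (suc zero) zero       _   i≢k = contradiction refl i≢k
two-values zero       (suc zero) (suc zero) _   _   = refl
two-values (suc zero) zero       zero       _   _   = refl
two-values (suc zero) zero       (suc zero) _   i≢k = contradiction refl i≢k
two-values (suc zero) (suc zero) _          i≢j _   = contradiction refl i≢j

-- A class is never its own mirror image, since reflection reverses the order of the first two
-- coordinates. This order therefore selects one of the two chambers of a pattern.
chambers↔sides×patterns : ∀ n → Bijection (DecSetoid.setoid (Chamber∼ (3 ℕ.+ n)))
  (≡.setoid (Fin 2) ×ₛ DecSetoid.setoid (Pattern≃ (3 ℕ.+ n)))
chambers↔sides×patterns n = mkBijection _ _ (λ (q , gen) → side q , (q , gen))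
  (λ {x} q∼r → side-cong (proj₂ x) q∼r , inj₁ q∼r)
  (λ {x} {y} → λ where
    (_  , inj₁ q∼r)  → q∼r
    (eq , inj₂ q∼-r) → contradiction (≡.trans (≡.sym eq) (side-cong (proj₂ x) q∼-r))
      (side-neg (proj₂ y)))
  λ (s , (q , gen)) → case s Fin.≟ side q of λ where
    (yes s≡) → (q , gen) , ≡.sym s≡ , inj₁ ∼-refl
    (no  s≢) → (neg q , neg-generic gen)
             , ≡.sym (two-values (side q) s (side (neg q)) (s≢ ∘ ≡.sym) (side-neg gen)) , inj₂
                 ∼-refl

-- The action of permutations on chambers

permutations : ℕ → Setoid _ _
permutations n = record
  { Carrier = Permutation′ n
  ; _≈_ = Perm._≈_
  ; isEquivalence = record
    { refl = λ _ → refl ; sym = λ p i → ≡.sym (p i) ; trans = λ p q i → ≡.trans (p i) (q i) }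
  }

permutations-card : ∀ n → permutations n HasCardinality (n !)
permutations-card ℕ.zero = mkBijection _ _ (λ _ → Perm.id) (λ _ ()) (λ { {zero} {zero} _ → refl })
    (λ _ → zero , λ ())
permutations-card (ℕ.suc n) = bijection (card-× (id-bijection (≡.setoid (Fin (ℕ.suc n))))
    (permutations-card n))
  (mkBijection _ (permutations (ℕ.suc n)) (λ (j , π) → Perm.insert zero j π)
    (λ { {j , π} (refl , π≈ρ) → λ { zero → refl ; (suc a) → ≡.cong (punchIn j) (π≈ρ a) } })
    inj
    λ π → (π ⟨$⟩ʳ zero , Perm.remove zero π) , Perm.insert-remove zero π)
  where
  inj : Injective (Setoid._≈_ (≡.setoid (Fin (ℕ.suc n)) ×ₛ permutations n)) (Perm._≈_)
          (λ (j , π) → Perm.insert zero j π)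
  inj {j , π} {k , ρ} eq with eq zero
  ... | refl = refl , λ a → Fin.punchIn-injective j _ _ (eq (suc a))

-- For increasing `q` the coordinates of `q ∘ π` are ordered as the values of `π` are, so the class
-- determines `π`, and undoing `π` gives back `q`. Every class is reached by sorting its coordinates
-- and acting with the inverse of the sorting permutation.
perms×increasing↔chambers : ∀ n → Bijection
  (permutations (3 ℕ.+ n) ×ₛ DecSetoid.setoid (Increasing∼ (3 ℕ.+ n)))
    (DecSetoid.setoid (Chamber∼ (3 ℕ.+ n)))
perms×increasing↔chambers n = mkBijection _ _
  (λ (π , (q , gen , _)) → q ∘ (π ⟨$⟩ʳ_) , perm-generic π gen)
  (λ { {π , (q , _)} {ρ , (r , _)} (π≈ρ , q∼r) →
    ∼-trans (perm-cong π q∼r) (≗⇒∼ λ i → ≡.cong r (π≈ρ i)) })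
  (λ { {π , (q , _ , q-inc)} {ρ , (r , _ , r-inc)} qπ∼rρ →
    let π≈ρ = sameOrder⇒≈ π ρ λ {i} {j} πi<πj → sorted-reflects {f = r} {σ = id} r-inc
                (∼⇒order qπ∼rρ {i} {j} (q-inc _ _ πi<πj))
    in π≈ρ
     , ∼-trans (≗⇒∼ λ i → ≡.cong q (≡.sym (Perm.inverseʳ π)))
         (∼-trans (perm-cong (Perm.flip π) (∼-trans qπ∼rρ (≗⇒∼ λ i → ≡.cong r (≡.sym (π≈ρ i)))))
           (≗⇒∼ λ i → ≡.cong r (Perm.inverseʳ π))) })
  λ (q , gen) → let π , sorted = sort q (generic⇒injective gen) in
    (Perm.flip π , (q ∘ (π ⟨$⟩ʳ_) , perm-generic π gen , sorted)) , ≗⇒∼ λ i → ≡.cong q (Perm.inverseʳ π)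

-- Eventually true properties

Eventually : (ℕ → Set) → Set
Eventually P = ∃[ N ] ∀ n → N ℕ.≤ n → P n

ev-map : {P Q : ℕ → Set} → (∀ {n} → P n → Q n) → Eventually P → Eventually Q
ev-map f (N , h) = N , λ n N≤n → f (h n N≤n)

ev-zip : {P Q R : ℕ → Set} → (∀ {n} → P n → Q n → R n) → Eventually P → Eventually Q → Eventually R
ev-zip f (M , g) (N , h) = M ℕ.⊔ N , λ n l≤n →
  f (g n (ℕ.m⊔n≤o⇒m≤o M N l≤n)) (h n (ℕ.m⊔n≤o⇒n≤o M N l≤n))

ev-witness : {P : ℕ → Set} → Eventually P → ∃ P
ev-witness (N , h) = N , h N ℕ.≤-refl

ev-∀ : {P : Fin m → ℕ → Set} → (∀ i → Eventually (P i)) → Eventually (λ n → ∀ i → P i n)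
ev-∀ {ℕ.zero}  h = 0 , λ _ _ ()
ev-∀ {ℕ.suc m} h = ev-zip (λ p ps → λ { zero → p ; (suc i) → ps i }) (h zero) (ev-∀ (h ∘ suc))

ev-→ : {A : Set} {P : ℕ → Set} → Dec A → (A → Eventually P) → Eventually (λ n → A → P n)
ev-→ (yes a) h = ev-map (λ p _ → p) (h a)
ev-→ (no ¬a) h = 0 , λ _ _ a → contradiction a ¬a

-- The order of ℝ

<ᴿ⇒ev : ∀ {x y} → x <ᴿ y → Eventually (λ n → seq x n < seq y n)
<ᴿ⇒ev (ε , 0<ε , ev) = ev-map (ℚ.<-trans (p<p+e _ 0<ε)) ev

<ᴿ-asym : ∀ {x y} → x <ᴿ y → ¬ y <ᴿ x
<ᴿ-asym {x} {y} x<y y<x = let _ , lt , gt = ev-witness (ev-zip _,_ (<ᴿ⇒ev {x} {y} x<y) (<ᴿ⇒ev {y} {x} y<x)) in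
  ℚ.<-asym lt gt

<ᴿ-trans : ∀ {x y z} → x <ᴿ y → y <ᴿ z → x <ᴿ z
<ᴿ-trans {x} {y} {z} (ε , 0<ε , ev) y<z = ε , 0<ε , ev-zip ℚ.<-trans ev (<ᴿ⇒ev {y} {z} y<z)

<ᴿ-dense : ∀ {x y} → x <ᴿ y → ∃[ z ] x <ᴿ z × z <ᴿ y
<ᴿ-dense {x} {y} (ε , 0<ε , ev) = half (x ℝ.+ y)
  , (½ ℚ.* ε , ½-pos 0<ε , ev-map (λ {n} h → shift-< (ℚ.*-monoʳ-<-pos ½ h)
      (solve 3 (λ x y e → con ½ :* (x :+ e) :+ con ½ :* (x :+ y) := x :+ con ½ :* e :+ con ½ :* y)
        refl
        (seq x n) (seq y n) ε)) ev)
  , (½ ℚ.* ε , ½-pos 0<ε , ev-map (λ {n} h → shift-< (ℚ.*-monoʳ-<-pos ½ h)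
      (solve 3 (λ x y e → con ½ :* (x :+ e) :+ y := con ½ :* (x :+ y) :+ con ½ :* e :+ con ½ :* y)
        refl
        (seq x n) (seq y n) ε)) ev)

0<½ : 0ℚ < ½
0<½ = ℚ.positive⁻¹ ½

<ᴿ-above : ∀ x → ∃[ y ] x <ᴿ y
<ᴿ-above x = x ℝ.+ const 1ℚ , ½ , 0<½ , 0 , λ n _ → shift-< (p<p+e 0ℚ 0<½)
  (solve 1 (λ x → con 0ℚ :+ (x :+ con 1ℚ) := x :+ con ½ :+ (con 0ℚ :+ con ½)) refl (seq x n))

<ᴿ-below : ∀ x → ∃[ y ] y <ᴿ x
<ᴿ-below x = x ℝ.- const 1ℚ , ½ , 0<½ , 0 , λ n _ → shift-< (p<p+e 0ℚ 0<½)
  (solve 1 (λ x → con 0ℚ :+ x := x :- con 1ℚ :+ con ½ :+ (con 0ℚ :+ con ½)) refl (seq x n))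

<ᴿ-cotrans : ∀ {x y} → x <ᴿ y → ∀ z → x <ᴿ z ⊎ z <ᴿ y
<ᴿ-cotrans {x} {y} (ε , 0<ε , N , gap) z = by-cases (seq x M + (ε - δ - δ - δ - δ) ℚ.≤? seq z M)
  where
  -- An eighth of the gap. The test compares `z` with `x + 4δ` at index `M`; the drifts of `x` and
  -- `z` after `M` cost at most `δ` each, and a gap of `2δ` is left on either outcome.
  δ = ½ ℚ.* (½ ℚ.* (½ ℚ.* ε))
  0<δ = ½-pos (½-pos (½-pos 0<ε))
  Mx = proj₁ (isCauchy x δ 0<δ)
  Mz = proj₁ (isCauchy z δ 0<δ)
  M = N ℕ.⊔ (Mx ℕ.⊔ Mz)
  N≤M : N ℕ.≤ M
  N≤M = ℕ.m≤m⊔n N _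
  Mx≤M : Mx ℕ.≤ M
  Mx≤M = ℕ.≤-trans (ℕ.m≤m⊔n Mx Mz) (ℕ.m≤n⊔m N _)
  Mz≤M : Mz ℕ.≤ M
  Mz≤M = ℕ.≤-trans (ℕ.m≤n⊔m Mx Mz) (ℕ.m≤n⊔m N _)
  x-near : ∀ n → M ℕ.≤ n → ∣ seq x M - seq x n ∣ < δ
  x-near n M≤n = proj₂ (isCauchy x δ 0<δ) M n Mx≤M (ℕ.≤-trans Mx≤M M≤n)
  z-near : ∀ n → M ℕ.≤ n → ∣ seq z M - seq z n ∣ < δ
  z-near n M≤n = proj₂ (isCauchy z δ 0<δ) M n Mz≤M (ℕ.≤-trans Mz≤M M≤n)
  by-cases : Dec (seq x M + (ε - δ - δ - δ - δ) ℚ.≤ seq z M) → x <ᴿ z ⊎ z <ᴿ y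
  by-cases (yes h) = inj₁ (δ + δ , +-pos 0<δ 0<δ , M , λ n M≤n →
    shift-< (ℚ.+-mono-≤-< h (ℚ.+-mono-< (close⁻ˡ {seq z M} {seq z n} (z-near n M≤n))
        (close⁻ʳ {seq x M} {seq x n} (x-near n M≤n))))
      (solve 5 (λ x z x′ z′ e → let d = con ½ :* (con ½ :* (con ½ :* e)) in
          x :+ (e :- d :- d :- d :- d) :+ (z :+ x′) :+ z′ :=
              x′ :+ (d :+ d) :+ (z :+ (z′ :+ d :+ (x :+ d)))) refl
        (seq x M) (seq z M) (seq x n) (seq z n) ε))
  by-cases (no h) = inj₂ (δ + δ , +-pos 0<δ 0<δ , M , λ n M≤n →
    shift-< (ℚ.+-mono-< (ℚ.≰⇒> h) (ℚ.+-mono-< (gap n (ℕ.≤-trans N≤M M≤n))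
              (ℚ.+-mono-< (close⁻ʳ {seq z M} {seq z n} (z-near n M≤n))
                (close⁻ˡ {seq x M} {seq x n} (x-near n M≤n)))))
      (solve 6 (λ x z x′ y′ z′ e → let d = con ½ :* (con ½ :* (con ½ :* e)) in
          z :+ (x′ :+ e :+ (z′ :+ x)) :+ y′ :=
              z′ :+ (d :+ d) :+ (x :+ (e :- d :- d :- d :- d) :+ (y′ :+ (z :+ d :+ (x′ :+ d)))))
                  refl
        (seq x M) (seq z M) (seq x n) (seq y n) (seq z n) ε))

betweenᴿ : (ls us : List ℝ) → All (λ l → All (l <ᴿ_) us) ls → ∃[ y ] All (_<ᴿ y) ls × All (y <ᴿ_) us
betweenᴿ = Between.between _<ᴿ_ (λ {x} {y} {z} → <ᴿ-trans {x} {y} {z})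
    (λ {x} {y} → <ᴿ-cotrans {x} {y})
  (λ {x} {y} → <ᴿ-dense {x} {y}) <ᴿ-above <ᴿ-below ℝ.0ℝ

<ᴿ-resp : ∀ {x x′ y y′} → (∀ n → seq x n ≡ seq x′ n) → (∀ n → seq y n ≡ seq y′ n) → x <ᴿ y →
    x′ <ᴿ y′
<ᴿ-resp x≗ y≗ (ε , 0<ε , N , gap) = ε , 0<ε , N , λ n N≤n →
  ≡.subst₂ (λ a b → a + ε < b) (x≗ n) (y≗ n) (gap n N≤n)

const-<ᴿ : ∀ {p q} → p < q → const p <ᴿ const q
const-<ᴿ {p} {q} p<q = ½ ℚ.* (q - p) , ½-pos (diff-pos⁺ p<q) , 0 , λ _ _ →
  shift-< (½-pos (diff-pos⁺ p<q)) (solve 2 (λ p q → con 0ℚ :+ q :=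
      p :+ con ½ :* (q :- p) :+ con ½ :* (q :- p)) refl p q)

half-<ᴿ : ∀ {x y} → x <ᴿ y → half x <ᴿ half y
half-<ᴿ {x} {y} (ε , 0<ε , ev) = ½ ℚ.* ε , ½-pos 0<ε , ev-map (λ {n} h →
  ≡.subst (_< ½ ℚ.* seq y n) (ℚ.*-distribˡ-+ ½ (seq x n) ε) (ℚ.*-monoʳ-<-pos ½ h)) ev

half-<ᴿ⁻ : ∀ {x y} → half x <ᴿ half y → x <ᴿ y
half-<ᴿ⁻ {x} {y} (ε , 0<ε , ev) = ε + ε , +-pos 0<ε 0<ε , ev-map (λ {n} h →
  shift-< (ℚ.+-mono-< h h) (solve 3 (λ x y e → con ½ :* x :+ e :+ (con ½ :* x :+ e) :+ y :=
      x :+ (e :+ e) :+ (con ½ :* y :+ con ½ :* y)) refl (seq x n) (seq y n) ε)) ev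

+-<ᴿ : ∀ z {x y} → x <ᴿ y → z ℝ.+ x <ᴿ z ℝ.+ y
+-<ᴿ z {x} {y} (ε , 0<ε , ev) = ε , 0<ε , ev-map (λ {n} h →
  ≡.subst (_< seq z n + seq y n) (≡.sym (ℚ.+-assoc (seq z n) (seq x n) ε))
      (ℚ.+-monoʳ-< (seq z n) h)) ev

+-<ᴿ⁻ : ∀ z {x y} → z ℝ.+ x <ᴿ z ℝ.+ y → x <ᴿ y
+-<ᴿ⁻ z {x} {y} (ε , 0<ε , ev) = ε , 0<ε , ev-map (λ {n} h →
  +-cancelˡ-< (seq z n) (≡.subst (_< seq z n + seq y n) (ℚ.+-assoc (seq z n) (seq x n) ε) h)) ev

-- Real configurations

-- A common form of `Generic` and `ArrangementComplement`: sums instead of midpoints, and pairs of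
-- distinct indices in any order.
record GenericR (x : ℝ^ m) : Set where
  constructor mkGenericR
  field apart : ∀ {i j k l} → i ≢ j → k ≢ l → ¬ SamePair i j k l → x i ℝ.+ x j # x k ℝ.+ x l

record Realises (x : ℝ^ m) (q : Point m) : Set where
  constructor mkRealises
  field realise : ∀ {i j k l} → i ≢ j → k ≢ l → q i + q j < q k + q l → x i ℝ.+ x j <ᴿ x k ℝ.+ x l

open GenericR
open Realises

const-realises : (q : Point m) → Realises (const ∘ q) q
const-realises q = mkRealises λ _ _ → const-<ᴿ

realises-cong : {x : ℝ^ m} {q r : Point m} → GenericQ q → q ∼ r → Realises x q → Realises x r
realises-cong gen q∼r real = mkRealises λ i≢j k≢l →
    realise real i≢j k≢l ∘ preserve (∼-sym gen q∼r) i≢j k≢l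

realises⇒generic : {x : ℝ^ m} {q : Point m} → GenericQ q → Realises x q → GenericR x
realises⇒generic {x = x} {q} gen real = mkGenericR decide
  where
  decide : ∀ {i j k l} → i ≢ j → k ≢ l → ¬ SamePair i j k l → x i ℝ.+ x j # x k ℝ.+ x l
  decide i≢j k≢l ¬s with pairOrder gen i≢j k≢l
  ... | same _ s = contradiction s ¬s
  ... | less lt  = inj₁ (realise real i≢j k≢l lt)
  ... | more gt  = inj₂ (realise real k≢l i≢j gt)

realises⇒order : {x : ℝ^ (3 ℕ.+ n)} {q : Point (3 ℕ.+ n)} → Realises x q → ∀ {i j} → q i < q j →
    x i <ᴿ x j
realises⇒order {x = x} {q} real {i} {j} qi<qj = let k , k≢i , k≢j = third i j in
  +-<ᴿ⁻ (x k) {x i} {x j} (realise real k≢i k≢j (ℚ.+-monoʳ-< (q k) qi<qj))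

realises⇒order⁻ : {x : ℝ^ (3 ℕ.+ n)} {q : Point (3 ℕ.+ n)} → GenericQ q → Realises x q →
                  ∀ {i j} → x i <ᴿ x j → q i < q j
realises⇒order⁻ {x = x} {q} gen real {i} {j} xi<xj with ℚ.<-cmp (q i) (q j)
... | tri< lt _ _ = lt
... | tri> _ _ gt = contradiction xi<xj (<ᴿ-asym {x j} {x i} (realises⇒order real gt))
... | tri≈ _ eq _ with generic⇒injective gen eq
...   | refl = contradiction xi<xj (<ᴿ-asym {x i} {x i} xi<xj)

const-realises⇒∼ : {q r : Point m} → GenericQ r → Realises (const ∘ q) r → q ∼ r
const-realises⇒∼ gen real = ∼-sym gen (mk∼ λ i≢j k≢l lt →
  let _ , h = ev-witness (<ᴿ⇒ev {const _} {const _} (realise real i≢j k≢l lt)) in h)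

approximate : {x : ℝ^ m} → GenericR x → ∃[ q ] GenericQ q × Realises x q
approximate {m} {x} gen = (λ i → seq (x i) N) , generic , realises
  where
  -- Only the first alternative keeps the real inequality. In the second the rational sums are in
  -- the opposite order, so this quadruple asks nothing of `x`; the exchanged quadruple does.
  Separated : Fin m → Fin m → Fin m → Fin m → ℕ → Set
  Separated i j k l n =
    (seq (x i ℝ.+ x j) n < seq (x k ℝ.+ x l) n × x i ℝ.+ x j <ᴿ x k ℝ.+ x l) ⊎
    (seq (x k ℝ.+ x l) n < seq (x i ℝ.+ x j) n)
  separated-ev : ∀ i j k l → Valid ((i , j) , (k , l)) → Eventually (Separated i j k l)
  separated-ev i j k l (i≢j , k≢l , ¬s) with apart gen i≢j k≢l ¬s
  ... | inj₁ lt = ev-map (λ h → inj₁ (h , lt)) (<ᴿ⇒ev {x i ℝ.+ x j} {x k ℝ.+ x l} lt)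
  ... | inj₂ gt = ev-map inj₂ (<ᴿ⇒ev {x k ℝ.+ x l} {x i ℝ.+ x j} gt)
  all-separated : ∃[ n ] ∀ i j k l → Valid ((i , j) , (k , l)) → Separated i j k l n
  all-separated = ev-witness (ev-∀ λ i → ev-∀ λ j → ev-∀ λ k → ev-∀ λ l →
    ev-→ (valid? ((i , j) , (k , l))) (separated-ev i j k l))
  N = proj₁ all-separated
  q : Point m
  q i = seq (x i) N
  generic : GenericQ q
  generic = mkGeneric λ {i} {j} {k} {l} i≢j k≢l ¬s eq → case proj₂ all-separated i j k l (i≢j , k≢l , ¬s) of λ where
    (inj₁ (lt , _)) → ℚ.<⇒≢ lt eq
    (inj₂ gt)       → ℚ.<⇒≢ gt (≡.sym eq)
  realises : Realises x q
  realises = mkRealises λ {i} {j} {k} {l} i≢j k≢l lt →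
    case proj₂ all-separated i j k l (i≢j , k≢l , λ s → ℚ.<⇒≢ lt (samePair⇒≡ q s)) of λ where
      (inj₁ (_ , lt′)) → lt′
      (inj₂ gt)        → contradiction gt (ℚ.<-asym lt)

#-sym : ∀ {x y} → x # y → y # x
#-sym = Sum.swap

#-comm-left : ∀ a b {c} → a ℝ.+ b # c → b ℝ.+ a # c
#-comm-left a b {c} = Sum.map
  (<ᴿ-resp {a ℝ.+ b} {b ℝ.+ a} {c} {c} (λ n → ℚ.+-comm (seq a n) (seq b n)) (λ _ → refl))
  (<ᴿ-resp {c} {c} {a ℝ.+ b} {b ℝ.+ a} (λ _ → refl) (λ n → ℚ.+-comm (seq a n) (seq b n)))

#-comm-right : ∀ {a} b c → a # b ℝ.+ c → a # c ℝ.+ b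
#-comm-right {a} b c h = #-sym {c ℝ.+ b} {a} (#-comm-left b c {a} (#-sym {a} {b ℝ.+ c} h))

+-# : ∀ z {x y} → x # y → z ℝ.+ x # z ℝ.+ y
+-# z {x} {y} = Sum.map (+-<ᴿ z {x} {y}) (+-<ᴿ z {y} {x})

+-#⁻ : ∀ z {x y} → z ℝ.+ x # z ℝ.+ y → x # y
+-#⁻ z {x} {y} = Sum.map (+-<ᴿ⁻ z {x} {y}) (+-<ᴿ⁻ z {y} {x})

generic⇒genericR : {x : ℝ^ m} → Generic x → GenericR x
generic⇒genericR {m} {x} gen = mkGenericR λ {i} {j} {k} {l} → unordered i j k l
  where
  ordered : ∀ i j k l → i Fin.< j → k Fin.< l → ¬ SamePair i j k l → x i ℝ.+ x j # x k ℝ.+ x l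
  ordered i j k l i<j k<l ¬s = Sum.map
    (half-<ᴿ⁻ {x i ℝ.+ x j} {x k ℝ.+ x l}) (half-<ᴿ⁻ {x k ℝ.+ x l} {x i ℝ.+ x j})
    (gen i j k l i<j k<l λ { refl → ¬s (inj₁ (refl , refl)) })
  unordered : ∀ i j k l → i ≢ j → k ≢ l → ¬ SamePair i j k l → x i ℝ.+ x j # x k ℝ.+ x l
  unordered i j k l i≢j k≢l ¬s with Fin.<-cmp i j | Fin.<-cmp k l
  ... | tri≈ _ eq _  | _            = contradiction eq i≢j
  ... | _            | tri≈ _ eq _  = contradiction eq k≢l
  ... | tri< i<j _ _ | tri< k<l _ _ = ordered i j k l i<j k<l ¬s
  ... | tri< i<j _ _ | tri> _ _ l<k = #-comm-right {x i ℝ.+ x j} (x l) (x k)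
        (ordered i j l k i<j l<k λ { (inj₁ (p , q)) → ¬s (inj₂ (p , q)) ; (inj₂ (p , q)) →
          ¬s (inj₁ (p , q)) })
  ... | tri> _ _ j<i | tri< k<l _ _ = #-comm-left (x j) (x i) {x k ℝ.+ x l}
        (ordered j i k l j<i k<l λ { (inj₁ (p , q)) → ¬s (inj₂ (q , p)) ; (inj₂ (p , q)) →
          ¬s (inj₁ (q , p)) })
  ... | tri> _ _ j<i | tri> _ _ l<k = #-comm-left (x j) (x i) {x k ℝ.+ x l}
      (#-comm-right {x j ℝ.+ x i} (x l) (x k)
        (ordered j i l k j<i l<k λ { (inj₁ (p , q)) → ¬s (inj₁ (q , p)) ; (inj₂ (p , q)) →
          ¬s (inj₂ (q , p)) }))

genericR⇒generic : {x : ℝ^ m} → GenericR x → Generic x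
genericR⇒generic {x = x} gen i j k l i<j k<l ij≢kl =
  Sum.map (half-<ᴿ {x i ℝ.+ x j} {x k ℝ.+ x l}) (half-<ᴿ {x k ℝ.+ x l} {x i ℝ.+ x j})
    (apart gen (Fin.<⇒≢ i<j) (Fin.<⇒≢ k<l) λ where
      (inj₁ (refl , refl)) → ij≢kl refl
      (inj₂ (refl , refl)) → Fin.<-asym i<j k<l)

genericR⇒complement : {x : ℝ^ (3 ℕ.+ n)} → GenericR x → ArrangementComplement x
genericR⇒complement {x = x} gen (equal i j i<j) = let k , k≢i , k≢j = third i j in
  +-#⁻ (x k) {x i} {x j} (apart gen k≢i k≢j λ where
    (inj₁ (_ , i≡j)) → Fin.<⇒≢ i<j i≡j
    (inj₂ (k≡j , _)) → k≢j k≡j)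
genericR⇒complement gen (mid i j k l ((i≢j ∷ i≢k ∷ i≢l ∷ []) ∷ _) i<j i<k k<l) =
  apart gen i≢j (Fin.<⇒≢ k<l) λ where
    (inj₁ (i≡k , _)) → i≢k i≡k
    (inj₂ (i≡l , _)) → i≢l i≡l

-- Two different pairs either share an index, which cancels and leaves two coordinates to compare,
-- or involve four distinct indices, which the symmetries of the equation bring into the normal form
-- of a `mid` hyperplane, one inequality at a time.
complement⇒genericR : {x : ℝ^ m} → ArrangementComplement x → GenericR x
complement⇒genericR {m} {x} compl = mkGenericR λ {i} {j} {k} {l} → pairs i j k l
  where
  Apart : (i j k l : Fin m) → Set
  Apart i j k l = x i ℝ.+ x j # x k ℝ.+ x l
  commˡ : ∀ i j k l → Apart i j k l → Apart j i k l
  commˡ i j k l = #-comm-left (x i) (x j) {x k ℝ.+ x l}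
  commʳ : ∀ i j k l → Apart i j k l → Apart i j l k
  commʳ i j k l = #-comm-right {x i ℝ.+ x j} (x k) (x l)
  flip : ∀ i j k l → Apart i j k l → Apart k l i j
  flip i j k l = #-sym {x i ℝ.+ x j} {x k ℝ.+ x l}
  coordinates : ∀ {i j} → i ≢ j → x i # x j
  coordinates {i} {j} i≢j with Fin.<-cmp i j
  ... | tri< i<j _ _ = compl (equal i j i<j)
  ... | tri≈ _ eq _  = contradiction eq i≢j
  ... | tri> _ _ j<i = #-sym {x j} {x i} (compl (equal j i j<i))
  Distinct : (i j k l : Fin m) → Set
  Distinct i j k l = i ≢ j × i ≢ k × i ≢ l × j ≢ k × j ≢ l × k ≢ l
  sorted₃ : ∀ {i j k l} → Distinct i j k l → i Fin.< j → i Fin.< k → k Fin.< l → Apart i j k l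
  sorted₃ (i≢j , i≢k , i≢l , j≢k , j≢l , k≢l) i<j i<k k<l =
    compl (mid _ _ _ _ ((i≢j ∷ i≢k ∷ i≢l ∷ []) ∷ (j≢k ∷ j≢l ∷ []) ∷ (k≢l ∷ []) ∷ [] ∷ []) i<j i<k
        k<l)
  sorted₂ : ∀ {i j k l} → Distinct i j k l → i Fin.< j → k Fin.< l → Apart i j k l
  sorted₂ {i} {j} {k} {l} d@(i≢j , i≢k , i≢l , j≢k , j≢l , k≢l) i<j k<l with Fin.<-cmp i k
  ... | tri< i<k _ _ = sorted₃ d i<j i<k k<l
  ... | tri≈ _ eq _  = contradiction eq i≢k
  ... | tri> _ _ k<i = flip k l i j
        (sorted₃ (k≢l , i≢k ∘ ≡.sym , j≢k ∘ ≡.sym , i≢l ∘ ≡.sym , j≢l ∘ ≡.sym , i≢j) k<l k<i i<j)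
  sorted₁ : ∀ {i j k l} → Distinct i j k l → i Fin.< j → Apart i j k l
  sorted₁ {i} {j} {k} {l} d@(i≢j , i≢k , i≢l , j≢k , j≢l , k≢l) i<j with Fin.<-cmp k l
  ... | tri< k<l _ _ = sorted₂ d i<j k<l
  ... | tri≈ _ eq _  = contradiction eq k≢l
  ... | tri> _ _ l<k = commʳ i j l k (sorted₂ (i≢j , i≢l , i≢k , j≢l , j≢k , k≢l ∘ ≡.sym) i<j l<k)
  unsorted : ∀ {i j k l} → Distinct i j k l → Apart i j k l
  unsorted {i} {j} {k} {l} d@(i≢j , i≢k , i≢l , j≢k , j≢l , k≢l) with Fin.<-cmp i j
  ... | tri< i<j _ _ = sorted₁ d i<j
  ... | tri≈ _ eq _  = contradiction eq i≢j
  ... | tri> _ _ j<i = commˡ j i k l (sorted₁ (i≢j ∘ ≡.sym , j≢k , j≢l , i≢k , i≢l , k≢l) j<i)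
  pairs : ∀ i j k l → i ≢ j → k ≢ l → ¬ SamePair i j k l → Apart i j k l
  pairs i j k l i≢j k≢l ¬s with i Fin.≟ k | i Fin.≟ l | j Fin.≟ k | j Fin.≟ l
  ... | yes refl | _        | _        | _        =
      +-# (x i) {x j} {x l} (coordinates λ { refl → ¬s (inj₁ (refl , refl)) })
  ... | no _     | yes refl | _        | _        = commʳ i j i k
        (+-# (x i) {x j} {x k} (coordinates λ { refl → ¬s (inj₂ (refl , refl)) }))
  ... | no _     | no i≢l   | yes refl | _        =
      commˡ j i j l (+-# (x j) {x i} {x l} (coordinates i≢l))
  ... | no i≢k   | no _     | no _     | yes refl =
      commˡ j i k j (commʳ j i j k (+-# (x j) {x i} {x k} (coordinates i≢k)))
  ... | no i≢k   | no i≢l   | no j≢k   | no j≢l   = unsorted (i≢j , i≢k , i≢l , j≢k , j≢l , k≢l)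

-- Ranking patterns of real configurations

closer-<ᴿ : ∀ {y u v} → u <ᴿ v → y <ᴿ half (u ℝ.+ v) → ℝ.∣ y ℝ.- u ∣ <ᴿ ℝ.∣ y ℝ.- v ∣
closer-<ᴿ {y} {u} {v} (δ , 0<δ , u<v) (ε , 0<ε , y<mid) = δ ℚ.⊓ ε , ⊓-pos 0<δ 0<ε , ev-zip
  (λ {n} h k → distance-< {seq y n} {seq u n} {seq v n}
    (ℚ.≤-<-trans (ℚ.+-monoʳ-≤ (seq u n) (ℚ.p⊓q≤p δ ε)) h)
    (ℚ.≤-<-trans (ℚ.+-monoʳ-≤ (seq y n + seq y n) (ℚ.p⊓q≤q δ ε))
      (shift-< (ℚ.+-mono-< (ℚ.+-mono-< k k) 0<ε)
        (solve 4 (λ y u v e → y :+ e :+ (y :+ e) :+ con 0ℚ :+ (u :+ v) :=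
            y :+ y :+ e :+ (con ½ :* (u :+ v) :+ con ½ :* (u :+ v) :+ e)) refl
          (seq y n) (seq u n) (seq v n) ε))))
  u<v y<mid

closer->ᴿ : ∀ {y u v} → v <ᴿ u → half (u ℝ.+ v) <ᴿ y → ℝ.∣ y ℝ.- u ∣ <ᴿ ℝ.∣ y ℝ.- v ∣
closer->ᴿ {y} {u} {v} (δ , 0<δ , v<u) (ε , 0<ε , mid<y) = δ ℚ.⊓ ε , ⊓-pos 0<δ 0<ε , ev-zip
  (λ {n} h k → distance-> {seq y n} {seq u n} {seq v n}
    (ℚ.≤-<-trans (ℚ.+-monoʳ-≤ (seq v n) (ℚ.p⊓q≤p δ ε)) h)
    (ℚ.≤-<-trans (ℚ.+-monoʳ-≤ (seq u n + seq v n) (ℚ.p⊓q≤q δ ε))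
      (shift-< (ℚ.+-mono-< (ℚ.+-mono-< k k) 0<ε)
        (solve 4 (λ y u v e → con ½ :* (u :+ v) :+ e :+ (con ½ :* (u :+ v) :+ e) :+ con 0ℚ :+
          (y :+ y) :=
            u :+ v :+ e :+ (y :+ y :+ e)) refl
          (seq y n) (seq u n) (seq v n) ε))))
  v<u mid<y

module _ {x : ℝ^ (3 ℕ.+ n)} {q : Point (3 ℕ.+ n)} (gen : GenericQ q) (real : Realises x q) where

  -- At late indices twice the term of `y` lies strictly between the two sums of terms of `x`. This
  -- excludes every other order of the pairs in `q`, because `x` realises `q`.
  RP⇒admits : ∀ {π} → RP x π → Admits q (π ⟨$⟩ʳ_)
  RP⇒admits {π} (y , closer) = mkAdmits separate
    where
    σ : Fin (3 ℕ.+ n) → Fin (3 ℕ.+ n)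
    σ = π ⟨$⟩ʳ_
    closer-ev : ∀ {a b} → a Fin.< b →
      Eventually (λ n → ∣ seq y n - seq (x (σ a)) n ∣ < ∣ seq y n - seq (x (σ b)) n ∣)
    closer-ev {a} {b} a<b = <ᴿ⇒ev {ℝ.∣ y ℝ.- x (σ a) ∣} {ℝ.∣ y ℝ.- x (σ b) ∣} (closer a b a<b)
    order-ev : ∀ {i j} → q i < q j → Eventually (λ n → seq (x i) n < seq (x j) n)
    order-ev {i} {j} lt = <ᴿ⇒ev {x i} {x j} (realises⇒order real lt)
    separate : ∀ {a b c d} → a Fin.< b → c Fin.< d → q (σ b) < q (σ a) → q (σ c) < q (σ d) →
               q (σ a) + q (σ b) < q (σ c) + q (σ d)
    separate {a} {b} {c} {d} a<b c<d desc asc = decide (pairOrder gen σa≢σb σc≢σd)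
      where
      σa≢σb : σ a ≢ σ b
      σa≢σb = order-≢ q desc ∘ ≡.sym
      σc≢σd : σ c ≢ σ d
      σc≢σd = order-≢ q asc
      terms-< : Eventually (λ n → seq (x (σ a) ℝ.+ x (σ b)) n < seq (x (σ c) ℝ.+ x (σ d)) n)
      terms-< = ev-zip ℚ.<-trans
        (ev-zip (λ {n} → distance⁻-> {seq y n}) (order-ev desc) (closer-ev a<b))
        (ev-zip (λ {n} → distance⁻-< {seq y n}) (order-ev asc) (closer-ev c<d))
      decide : PairOrder q (σ a) (σ b) (σ c) (σ d) → q (σ a) + q (σ b) < q (σ c) + q (σ d)
      decide (less lt)  = lt
      decide (same _ s) = let n , lt = ev-witness terms-< in
        contradiction (samePair⇒≡ (λ i → seq (x i) n) s) (ℚ.<⇒≢ lt)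
      decide (more gt)  = let n , lt , gt′ = ev-witness (ev-zip _,_ terms-<
                                (<ᴿ⇒ev {x (σ c) ℝ.+ x (σ d)} {x (σ a) ℝ.+ x (σ b)}
                                  (realise real σc≢σd σa≢σb gt))) in
        contradiction lt (ℚ.<-asym gt′)

  -- Ascents and descents are read off `q`, where they are decidable; the midpoints to be separated
  -- by `y` are those of `x`, finite in number, so `betweenᴿ` applies.
  admits⇒RP : ∀ {π} → Admits q (π ⟨$⟩ʳ_) → RP x π
  admits⇒RP {π} adm = let y , lows≺y , y≺ups = betweenᴿ lows ups separated-lists in y , closer y lows≺y y≺ups
    where
    σ : Fin (3 ℕ.+ n) → Fin (3 ℕ.+ n)
    σ = π ⟨$⟩ʳ_
    Pair : Set
    Pair = Fin (3 ℕ.+ n) × Fin (3 ℕ.+ n)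
    Descent Ascent : Pair → Set
    Descent (a , b) = a Fin.< b × q (σ b) < q (σ a)
    Ascent  (a , b) = a Fin.< b × q (σ a) < q (σ b)
    descent? : (p : Pair) → Dec (Descent p)
    descent? (a , b) = a Fin.<? b ×-dec q (σ b) ℚ.<? q (σ a)
    ascent? : (p : Pair) → Dec (Ascent p)
    ascent? (a , b) = a Fin.<? b ×-dec q (σ a) ℚ.<? q (σ b)
    pairs : List Pair
    pairs = cartesianProduct (allFin _) (allFin _)
    ∈-pairs : ∀ a b → Any ((a , b) ≡_) pairs
    ∈-pairs a b = Membership.∈-cartesianProduct⁺ (Membership.∈-allFin a) (Membership.∈-allFin b)
    middle : Pair → ℝ
    middle (a , b) = midpoint x (σ a) (σ b)
    separated-pair : ∀ p r → Descent p → Ascent r → middle p <ᴿ middle r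
    separated-pair (a , b) (c , d) (a<b , desc) (c<d , asc) =
      half-<ᴿ {x (σ a) ℝ.+ x (σ b)} {x (σ c) ℝ.+ x (σ d)}
        (realise real (order-≢ q desc ∘ ≡.sym) (order-≢ q asc) (separated adm a<b c<d desc asc))
    lows ups : List ℝ
    lows = map middle (filter descent? pairs)
    ups  = map middle (filter ascent? pairs)
    separated-lists : All (λ l → All (l <ᴿ_) ups) lows
    separated-lists = All.map⁺ {f = middle} (All.tabulate λ {p} p∈ →
        All.map⁺ {f = middle} (All.tabulate λ {r} r∈ →
      separated-pair p r (proj₂ (Membership.∈-filter⁻ descent? {xs = pairs} p∈))
                         (proj₂ (Membership.∈-filter⁻ ascent? {xs = pairs} r∈))))
    closer : ∀ y → All (_<ᴿ y) lows → All (y <ᴿ_) ups →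
             ∀ a b → a Fin.< b → ℝ.∣ y ℝ.- x (σ a) ∣ <ᴿ ℝ.∣ y ℝ.- x (σ b) ∣
    closer y lows≺y y≺ups a b a<b with ℚ.<-cmp (q (σ a)) (q (σ b))
    ... | tri< asc _ _ = closer-<ᴿ {y} {x (σ a)} {x (σ b)} (realises⇒order real asc)
          (All.lookup (All.map⁻ {f = middle} y≺ups)
            (Membership.∈-filter⁺ ascent? (∈-pairs a b) (a<b , asc)))
    ... | tri> _ _ desc = closer->ᴿ {y} {x (σ a)} {x (σ b)} (realises⇒order real desc)
          (All.lookup (All.map⁻ {f = middle} lows≺y)
            (Membership.∈-filter⁺ descent? (∈-pairs a b) (a<b , desc)))
    ... | tri≈ _ eq _ = contradiction (perm-injective π (generic⇒injective gen eq)) (Fin.<⇒≢ a<b)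

-- Closeness of rationals and midpoints

close-zero : ∀ p {e} → 0ℚ < e → ∣ p - p ∣ < e
close-zero p 0<e = close⁺ {p} {p} (p<p+e p 0<e) (p<p+e p 0<e)

close-sym : ∀ p q {e} → ∣ p - q ∣ < e → ∣ q - p ∣ < e
close-sym p q h = close⁺ {q} {p} (close⁻ʳ {p} {q} h) (close⁻ˡ {p} {q} h)

close-trans : ∀ p q r {d e} → ∣ p - q ∣ < d → ∣ q - r ∣ < e → ∣ p - r ∣ < d + e
close-trans p q r {d} {e} h k = close⁺ {p} {r}
  (shift-< (ℚ.+-mono-< (close⁻ˡ {p} {q} h) (close⁻ˡ {q} {r} k))
    (solve 5 (λ p q r d e → p :+ q :+ (r :+ (d :+ e)) := p :+ (q :+ d :+ (r :+ e))) refl p q r d e))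
  (shift-< (ℚ.+-mono-< (close⁻ʳ {p} {q} h) (close⁻ʳ {q} {r} k))
    (solve 5 (λ p q r d e → q :+ r :+ (p :+ (d :+ e)) := r :+ (p :+ d :+ (q :+ e))) refl p q r d e))

close-midpoint : ∀ p q p′ q′ {e} → ∣ p - p′ ∣ < e → ∣ q - q′ ∣ < e →
  ∣ ½ ℚ.* (p + q) - ½ ℚ.* (p′ + q′) ∣ < e
close-midpoint p q p′ q′ {e} h k = close⁺ {½ ℚ.* (p + q)} {½ ℚ.* (p′ + q′)}
  (shift-< (ℚ.*-monoʳ-<-pos ½ (ℚ.+-mono-< (close⁻ˡ {p} {p′} h) (close⁻ˡ {q} {q′} k)))
    (solve 5 (λ p q p′ q′ e → con ½ :* (p :+ q) :+ (con ½ :* (p′ :+ q′) :+ e) :=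
        con ½ :* (p :+ q) :+ con ½ :* (p′ :+ e :+ (q′ :+ e))) refl p q p′ q′ e))
  (shift-< (ℚ.*-monoʳ-<-pos ½ (ℚ.+-mono-< (close⁻ʳ {p} {p′} h) (close⁻ʳ {q} {q′} k)))
    (solve 5 (λ p q p′ q′ e → con ½ :* (p′ :+ q′) :+ (con ½ :* (p :+ q) :+ e) :=
        con ½ :* (p′ :+ q′) :+ con ½ :* (p :+ e :+ (q :+ e))) refl p q p′ q′ e))

close-halve : ∀ p q {e} → ∣ q - p ∣ < e → ∣ ½ ℚ.* (p + q) - p ∣ < ½ ℚ.* e
close-halve p q {e} h = close⁺ {½ ℚ.* (p + q)} {p}
  (shift-< (ℚ.*-monoʳ-<-pos ½ (close⁻ˡ {q} {p} h))
    (solve 3 (λ p q e → con ½ :* q :+ (p :+ con ½ :* e) := con ½ :* (p :+ q) :+ con ½ :* (p :+ e))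
      refl p q e))
  (shift-< (ℚ.*-monoʳ-<-pos ½ (close⁻ʳ {q} {p} h))
    (solve 3 (λ p q e → con ½ :* p :+ (con ½ :* (p :+ q) :+ con ½ :* e) := p :+ con ½ :* (q :+ e))
      refl p q e))

close-halve′ : ∀ p q {e} → ∣ q - p ∣ < e → ∣ q - ½ ℚ.* (p + q) ∣ < ½ ℚ.* e
close-halve′ p q {e} h = close-sym (½ ℚ.* (p + q)) q
    (≡.subst (λ s → ∣ ½ ℚ.* s - q ∣ < ½ ℚ.* e) (ℚ.+-comm q p)
  (close-halve q p (close-sym q p h)))

bounded : ∀ x → ∃[ B ] Eventually (λ n → ∣ seq x n ∣ < B)
bounded x = ∣ seq x N ∣ + 1ℚ , N , λ n N≤n → shift-<
  (ℚ.+-mono-≤-< (ℚ.≤-trans (ℚ.≤-reflexive (≡.cong ∣_∣ (split (seq x n) (seq x N))))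
    (ℚ.∣p+q∣≤∣p∣+∣q∣ (seq x N) (seq x n - seq x N)))
    (proj₂ (isCauchy x 1ℚ 0<1) n N N≤n ℕ.≤-refl))
  (solve 3 (λ a b c → a :+ c :+ (b :+ con 1ℚ) := a :+ (b :+ c :+ con 1ℚ)) refl
    (∣ seq x n ∣) (∣ seq x N ∣) (∣ seq x n - seq x N ∣))
  where
  N = proj₁ (isCauchy x 1ℚ 0<1)
  split : ∀ a b → a ≡ b + (a - b)
  split = solve 2 (λ a b → a := b :+ (a :- b)) refl

-- Bisection

middle : ℝ^ m → ℝ^ m → ℝ^ m
middle a b i = half (a i ℝ.+ b i)

MidpointConvex : (ℝ^ m → Set) → Set
MidpointConvex P = ∀ a b → P a → P b → P (middle a b)

-- Weaker than convergence: a single term within each radius suffices to enter an open set around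
-- `z`.
_ApproximatedBy_ : ℝ^ m → (ℕ → ℝ^ m) → Set
z ApproximatedBy p = ∀ ρ → ℝ.0ℝ <ᴿ ρ → ∃[ k ] ∀ i → ℝ.∣ z i ℝ.- p k i ∣ <ᴿ ρ

open-reached : {U : Subset m} → Open U → ∀ z → z ∈ U → ∀ p → z ApproximatedBy p → ∃[ k ] p k ∈ U
open-reached U-open z z∈U p approx =
  let ρ , 0<ρ , ball = U-open z z∈U
      k , close = approx ρ 0<ρ
  in k , ball (p k) close

-- Bisecting a segment of C whose ends lie in U and V, always keeping a half of the same kind.
-- Everything is controlled termwise: at a fixed index n, the ends form nested rational intervals.
module Bisection {m : ℕ} {C U V : Subset m} (C-convex : MidpointConvex (_∈ C))
  (C⊆U∪V : C ⊆ U ∪ V) {u v : ℝ^ m} (u∈C : u ∈ C) (u∈U : u ∈ U) (v∈C : v ∈ C) (v∈V : v ∈ V) where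

  record Segment : Set where
    constructor segment
    field
      {left right} : ℝ^ m
      left∈C  : left ∈ C
      left∈U  : left ∈ U
      right∈C : right ∈ C
      right∈V : right ∈ V
  open Segment public

  middle∈C : ∀ s → middle (left s) (right s) ∈ C
  middle∈C s = C-convex (left s) (right s) (left∈C s) (right∈C s)

  midSide : ∀ s → middle (left s) (right s) ∈ U ⊎ middle (left s) (right s) ∈ V
  midSide s = C⊆U∪V {middle (left s) (right s)} (middle∈C s)

  halfAt : ∀ s → middle (left s) (right s) ∈ U ⊎ middle (left s) (right s) ∈ V → Segment
  halfAt s (inj₁ ∈U) = segment {middle (left s) (right s)} {right s} (middle∈C s) ∈U (right∈C s)
      (right∈V s)
  halfAt s (inj₂ ∈V) = segment {left s} {middle (left s) (right s)} (left∈C s) (left∈U s)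
      (middle∈C s) ∈V

  bisect : Segment → Segment
  bisect s = halfAt s (midSide s)

  segments : ℕ → Segment
  segments ℕ.zero    = segment u∈C u∈U v∈C v∈V
  segments (ℕ.suc k) = bisect (segments k)

  a b : ℕ → ℝ^ m
  a k = left (segments k)
  b k = right (segments k)

  bisect-inherits : (P : ℝ^ m → Set) → MidpointConvex P → ∀ s →
    P (left s) → P (right s) → P (left (bisect s)) × P (right (bisect s))
  bisect-inherits P convex s pa pb = go (midSide s)
    where
    go : ∀ d → P (left (halfAt s d)) × P (right (halfAt s d))
    go (inj₁ _) = convex (left s) (right s) pa pb , pb
    go (inj₂ _) = pa , convex (left s) (right s) pa pb

  -- All estimates on the bisection come from this. At fixed indices, closeness to a given rational,
  -- oscillation between two indices and a gap between two sums are midpoint-convex.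
  inherits : (P : ℝ^ m → Set) → MidpointConvex P → ∀ {k l} → k ℕ.≤′ l → P (a k) → P (b k) →
      P (a l) × P (b l)
  inherits P convex ℕ.≤′-refl pa pb = pa , pb
  inherits P convex (ℕ.≤′-step {l} k≤l) pa pb = let qa , qb = inherits P convex k≤l pa pb in
    bisect-inherits P convex (segments l) qa qb

  width : ∀ n i {B} → ∣ seq (v i) n - seq (u i) n ∣ < B → ∀ k →
      ∣ seq (b k i) n - seq (a k i) n ∣ < halve k B
  width n i h ℕ.zero = h
  width n i {B} h (ℕ.suc k) = go (midSide (segments k))
    where
    go : ∀ d → ∣ seq (right (halfAt (segments k) d) i) n - seq (left (halfAt (segments k) d) i) n ∣
        < ½ ℚ.* halve k B
    go (inj₁ _) = close-halve′ (seq (a k i) n) (seq (b k i) n) (width n i h k)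
    go (inj₂ _) = close-halve (seq (a k i) n) (seq (b k i) n) (width n i h k)

  term-near-convex : ∀ n i c e → MidpointConvex {m} (λ x → ∣ seq (x i) n - c ∣ < e)
  term-near-convex n i c e x y h k = ≡.subst (λ d → ∣ ½ ℚ.* (seq (x i) n + seq (y i) n) - d ∣ < e)
    (solve 1 (λ c → con ½ :* (c :+ c) := c) refl c)
    (close-midpoint (seq (x i) n) (seq (y i) n) c c h k)

  -- Through `inherits`, a Cauchy modulus common to `u` and `v` serves all ends of all segments at
  -- once, which a diagonal sequence requires.
  oscillation-convex : ∀ n n′ i e → MidpointConvex {m} (λ x → ∣ seq (x i) n - seq (x i) n′ ∣ < e)
  oscillation-convex n n′ i e x y h k =
    close-midpoint (seq (x i) n) (seq (y i) n) (seq (x i) n′) (seq (y i) n′) h k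

  -- All later ends lie in the k-th segment.
  near : ∀ k l → k ℕ.≤ l → ∀ n i {B e} → ∣ seq (v i) n - seq (u i) n ∣ < B → halve k B < e →
      0ℚ < e →
    ∣ seq (a l i) n - seq (a k i) n ∣ < e × ∣ seq (a l i) n - seq (b k i) n ∣ < e
  near k l k≤l n i {B} {e} h small 0<e =
      proj₁ (inherits (λ x → ∣ seq (x i) n - α ∣ < e) (term-near-convex n i α e) (ℕ.≤⇒≤′ k≤l)
        (close-zero α 0<e) w)
    , proj₁ (inherits (λ x → ∣ seq (x i) n - β ∣ < e) (term-near-convex n i β e) (ℕ.≤⇒≤′ k≤l)
        (close-sym β α w) (close-zero β 0<e))
    where
    α = seq (a k i) n
    β = seq (b k i) n
    w : ∣ β - α ∣ < e
    w = ℚ.<-trans (width n i h k) small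

  bound : ∀ i → ∃[ B ] Eventually (λ n → ∣ seq (v i) n - seq (u i) n ∣ < B)
  bound i = bounded (v i ℝ.- u i)

  -- The terms at `p` and `q` are joined through the `N`-th left end: from `a p` to `a N` at index
  -- `p`, along `a N` from `p` to `q`, and from `a N` to `a q` at index `q`. Each step costs `δ`, a
  -- quarter of `ε`, and one quarter is spare.
  limit-cauchy : ∀ i → ℝ.IsCauchy (λ n → seq (a n i) n)
  limit-cauchy i ε 0<ε = N , λ p q N≤p N≤q → ≡.subst (∣ seq (a p i) p - seq (a q i) q ∣ <_)
      δ+δ+δ+δ≡ε
      (close-trans (seq (a p i) p) (seq (a N i) q) (seq (a q i) q)
        (close-trans (seq (a p i) p) (seq (a N i) p) (seq (a N i) q) (to-N p N≤p)
          (in-N p q N≤p N≤q))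
        (ℚ.<-trans (close-sym (seq (a q i) q) (seq (a N i) q) (to-N q N≤q)) (p<p+e δ 0<δ)))
    where
    δ = ½ ℚ.* (½ ℚ.* ε)
    0<δ = ½-pos (½-pos 0<ε)
    δ+δ+δ+δ≡ε : δ + δ + (δ + δ) ≡ ε
    δ+δ+δ+δ≡ε = ≡.trans (≡.cong₂ _+_ (½+½ (½ ℚ.* ε)) (½+½ (½ ℚ.* ε))) (½+½ ε)
    B = proj₁ (bound i)
    N₁ = proj₁ (isCauchy (u i) δ 0<δ)
    N₂ = proj₁ (isCauchy (v i) δ 0<δ)
    N₃ = proj₁ (proj₂ (bound i))
    N₄ = proj₁ (halve-small B 0<δ)
    N = (N₁ ℕ.⊔ N₂) ℕ.⊔ (N₃ ℕ.⊔ N₄)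
    ≤₁ : N₁ ℕ.≤ N
    ≤₁ = ℕ.≤-trans (ℕ.m≤m⊔n N₁ N₂) (ℕ.m≤m⊔n _ (N₃ ℕ.⊔ N₄))
    ≤₂ : N₂ ℕ.≤ N
    ≤₂ = ℕ.≤-trans (ℕ.m≤n⊔m N₁ N₂) (ℕ.m≤m⊔n _ (N₃ ℕ.⊔ N₄))
    ≤₃ : N₃ ℕ.≤ N
    ≤₃ = ℕ.≤-trans (ℕ.m≤m⊔n N₃ N₄) (ℕ.m≤n⊔m (N₁ ℕ.⊔ N₂) _)
    ≤₄ : N₄ ℕ.≤ N
    ≤₄ = ℕ.≤-trans (ℕ.m≤n⊔m N₃ N₄) (ℕ.m≤n⊔m (N₁ ℕ.⊔ N₂) _)
    to-N : ∀ p → N ℕ.≤ p → ∣ seq (a p i) p - seq (a N i) p ∣ < δ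
    to-N p N≤p = proj₁ (near N p N≤p p i {B} (proj₂ (proj₂ (bound i)) p (ℕ.≤-trans ≤₃ N≤p))
        (proj₂ (halve-small B 0<δ) N ≤₄) 0<δ)
    in-N : ∀ p q → N ℕ.≤ p → N ℕ.≤ q → ∣ seq (a N i) p - seq (a N i) q ∣ < δ
    in-N p q N≤p N≤q = proj₁ (inherits (λ x → ∣ seq (x i) p - seq (x i) q ∣ < δ)
      (oscillation-convex p q i δ) {0} {N} (ℕ.≤⇒≤′ ℕ.z≤n)
      (proj₂ (isCauchy (u i) δ 0<δ) p q (ℕ.≤-trans ≤₁ N≤p) (ℕ.≤-trans ≤₁ N≤q))
      (proj₂ (isCauchy (v i) δ 0<δ) p q (ℕ.≤-trans ≤₂ N≤p) (ℕ.≤-trans ≤₂ N≤q)))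

  -- Taking the term at `n` from the `n`-th left end lets every midpoint-convex bound that `u` and
  -- `v` satisfy at index `n` pass to the limit.
  limit : ℝ^ m
  limit i = mkℝ (λ n → seq (a n i) n) (limit-cauchy i)

  limit-near : ∀ ρ → ℝ.0ℝ <ᴿ ρ → ∃[ k ] ∀ i →
    ℝ.∣ limit i ℝ.- a k i ∣ <ᴿ ρ × ℝ.∣ limit i ℝ.- b k i ∣ <ᴿ ρ
  limit-near ρ (δ , 0<δ , δ<ρ) = k , λ i →
      (½ ℚ.* δ , 0<½δ , ev-map (λ {n} (h , lt) → gap n (proj₁ h) lt) (both i))
    , (½ ℚ.* δ , 0<½δ , ev-map (λ {n} (h , lt) → gap n (proj₂ h) lt) (both i))
    where
    0<½δ = ½-pos 0<δ
    thin : ∃[ k ] ∀ i → halve k (proj₁ (bound i)) < ½ ℚ.* δ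
    thin = ev-witness (ev-∀ λ i → halve-small (proj₁ (bound i)) 0<½δ)
    k = proj₁ thin
    both : ∀ i → Eventually (λ n →
      (∣ seq (a n i) n - seq (a k i) n ∣ < ½ ℚ.* δ × ∣ seq (a n i) n - seq (b k i) n ∣ < ½ ℚ.* δ) ×
        0ℚ + δ < seq ρ n)
    both i = ev-zip _,_
      (ev-zip (λ {n} k≤n h → near k n k≤n n i h (proj₂ thin i) 0<½δ) (k , λ _ k≤n → k≤n)
        (proj₂ (bound i))) δ<ρ
    gap : ∀ n {d} → d < ½ ℚ.* δ → 0ℚ + δ < seq ρ n → d + ½ ℚ.* δ < seq ρ n
    gap n {d} h lt = shift-< (ℚ.+-mono-< h lt)
      (solve 3 (λ d e r → d :+ (con 0ℚ :+ e) :+ r := d :+ con ½ :* e :+ (con ½ :* e :+ r)) refl d δ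
        (seq ρ n))

  limit-near-a : limit ApproximatedBy a
  limit-near-a ρ 0<ρ = let k , close = limit-near ρ 0<ρ in k , λ i → proj₁ (close i)

  limit-near-b : limit ApproximatedBy b
  limit-near-b ρ 0<ρ = let k , close = limit-near ρ 0<ρ in k , λ i → proj₂ (close i)

  -- Left ends lie in `U`, right ends in `V`, and both come arbitrarily close to the limit.
  -- Whichever set contains the limit, its openness captures an end belonging to the other set.
  meet : Open U → Open V → limit ∈ C → C ≬ (U ∩ V)
  meet U-open V-open limit∈C = go (C⊆U∪V {limit} limit∈C)
    where
    inU : ∃[ k ] b k ∈ U → C ≬ (U ∩ V)
    inU (k , b∈U) = b k , right∈C (segments k) , b∈U , right∈V (segments k)
    inV : ∃[ k ] a k ∈ V → C ≬ (U ∩ V)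
    inV (k , a∈V) = a k , left∈C (segments k) , left∈U (segments k) , a∈V
    go : limit ∈ U ⊎ limit ∈ V → C ≬ (U ∩ V)
    go (inj₁ ∈U) = inU (open-reached U-open limit ∈U b limit-near-b)
    go (inj₂ ∈V) = inV (open-reached V-open limit ∈V a limit-near-a)

-- Regions are the chambers

HalfSpace : (i j k l : Fin m) → Subset m
HalfSpace i j k l x = x i ℝ.+ x j <ᴿ x k ℝ.+ x l

halfSpace-open : (i j k l : Fin m) → Open (HalfSpace i j k l)
halfSpace-open i j k l x (ε , 0<ε , gap) = const δ , const-<ᴿ 0<δ , λ y close →
  let near : ∀ i → Eventually (λ n → ∣ seq (x i) n - seq (y i) n ∣ < δ)
      near i = <ᴿ⇒ev {ℝ.∣ x i ℝ.- y i ∣} {const δ} (close i)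
  in ½ ℚ.* ε , ½-pos 0<ε , ev-zip
    (λ {n} (h , hi , hj) (hk , hl) → shift-<
      (ℚ.+-mono-< (ℚ.+-mono-< h (ℚ.+-mono-< (close⁻ʳ {seq (x i) n} {seq (y i) n} hi)
        (close⁻ʳ {seq (x j) n} {seq (y j) n} hj)))
                  (ℚ.+-mono-< (close⁻ˡ {seq (x k) n} {seq (y k) n} hk)
                    (close⁻ˡ {seq (x l) n} {seq (y l) n} hl)))
      (arith (seq (x i) n) (seq (x j) n) (seq (x k) n) (seq (x l) n)
             (seq (y i) n) (seq (y j) n) (seq (y k) n) (seq (y l) n) ε))
    (ev-zip _,_ gap (ev-zip _,_ (near i) (near j))) (ev-zip _,_ (near k) (near l))
  where
  -- Four coordinates may move by an eighth of the gap each, which uses up half of it and leaves the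
  -- other half.
  δ = ½ ℚ.* (½ ℚ.* (½ ℚ.* ε))
  0<δ = ½-pos (½-pos (½-pos 0<ε))
  arith : ∀ xi xj xk xl yi yj yk yl ε → let d = ½ ℚ.* (½ ℚ.* (½ ℚ.* ε)) in
    xi + xj + ε + (yi + yj) + (xk + xl) + (yk + yl) ≡
    yi + yj + ½ ℚ.* ε + (xk + xl + (xi + d + (xj + d)) + (yk + d + (yl + d)))
  arith = solve 9 (λ xi xj xk xl yi yj yk yl ε → let d = con ½ :* (con ½ :* (con ½ :* ε)) in
    xi :+ xj :+ ε :+ (yi :+ yj) :+ (xk :+ xl) :+ (yk :+ yl) :=
    yi :+ yj :+ con ½ :* ε :+ (xk :+ xl :+ (xi :+ d :+ (xj :+ d)) :+ (yk :+ d :+ (yl :+ d)))) refl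

Region : Point m → Subset m
Region q x = Realises x q

-- A point of `D` violating one of the inequalities would make `D` meet both open half-spaces of
-- that comparison. These cover `D` since its points are generic, so connectedness would give a
-- point in both, though they are disjoint.
connected⇒⊆region : {D : Subset m} → Connected D → D ⊆ GenericR → {q : Point m} {x : ℝ^ m} →
  x ∈ D → Realises x q → D ⊆ Region q
connected⇒⊆region {m} {D} conn D⊆gen {q} {x} x∈D x-real {z} z∈D = mkRealises λ {i} {j} {k} {l} →
    order i j k l
  where
  order : ∀ i j k l → i ≢ j → k ≢ l → q i + q j < q k + q l → z i ℝ.+ z j <ᴿ z k ℝ.+ z l
  order i j k l i≢j k≢l lt = decide (apart (D⊆gen z∈D) i≢j k≢l ¬s)
    where
    ¬s : ¬ SamePair i j k l
    ¬s s = ℚ.<⇒≢ lt (samePair⇒≡ q s)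
    decide : z i ℝ.+ z j # z k ℝ.+ z l → z i ℝ.+ z j <ᴿ z k ℝ.+ z l
    decide (inj₁ lt′) = lt′
    decide (inj₂ gt)  =
      let w , _ , w-lt , w-gt = conn (HalfSpace i j k l) (HalfSpace k l i j)
            (halfSpace-open i j k l) (halfSpace-open k l i j)
            (λ w∈D → apart (D⊆gen w∈D) i≢j k≢l ¬s)
            (x , x∈D , realise x-real i≢j k≢l lt) (z , z∈D , gt)
      in contradiction w-gt (<ᴿ-asym {w i ℝ.+ w j} {w k ℝ.+ w l} w-lt)

gap-convex : (i j k l : Fin m) (n : ℕ) (ε : ℚ) →
  MidpointConvex (λ x → seq (x i) n + seq (x j) n + ε < seq (x k) n + seq (x l) n)
gap-convex i j k l n ε x y h g = shift-< (ℚ.*-monoʳ-<-pos ½ (ℚ.+-mono-< h g))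
  (arith (seq (x i) n) (seq (x j) n) (seq (x k) n) (seq (x l) n)
         (seq (y i) n) (seq (y j) n) (seq (y k) n) (seq (y l) n) ε)
  where
  arith : ∀ xi xj xk xl yi yj yk yl ε →
    ½ ℚ.* (xi + xj + ε + (yi + yj + ε)) + (½ ℚ.* (xk + yk) + ½ ℚ.* (xl + yl)) ≡
    ½ ℚ.* (xi + yi) + ½ ℚ.* (xj + yj) + ε + ½ ℚ.* (xk + xl + (yk + yl))
  arith = solve 9 (λ xi xj xk xl yi yj yk yl ε →
    con ½ :* (xi :+ xj :+ ε :+ (yi :+ yj :+ ε)) :+ (con ½ :* (xk :+ yk) :+ con ½ :* (xl :+ yl)) :=
    con ½ :* (xi :+ yi) :+ con ½ :* (xj :+ yj) :+ ε :+ con ½ :* (xk :+ xl :+ (yk :+ yl))) refl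

-- The gap is uniform in the index, as the limit of the bisections is a diagonal sequence.
common-gap : {i j k l : Fin m} (x y : ℝ^ m) → HalfSpace i j k l x → HalfSpace i j k l y →
  ∃[ ε ] 0ℚ < ε × Eventually (λ n → seq (x i) n + seq (x j) n + ε < seq (x k) n + seq (x l) n ×
                                    seq (y i) n + seq (y j) n + ε < seq (y k) n + seq (y l) n)
common-gap {i = i} {j} x y (δ , 0<δ , x-gap) (ε , 0<ε , y-gap) = δ ℚ.⊓ ε , ⊓-pos 0<δ 0<ε , ev-zip
  (λ {n} h g → ℚ.≤-<-trans (ℚ.+-monoʳ-≤ (seq (x i) n + seq (x j) n) (ℚ.p⊓q≤p δ ε)) h
             , ℚ.≤-<-trans (ℚ.+-monoʳ-≤ (seq (y i) n + seq (y j) n) (ℚ.p⊓q≤q δ ε)) g)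
  x-gap y-gap

region-convex : (q : Point m) → MidpointConvex (Region q)
region-convex q x y x-real y-real = mkRealises λ {i} {j} {k} {l} i≢j k≢l lt →
  let ε , 0<ε , ev = common-gap x y (realise x-real i≢j k≢l lt) (realise y-real i≢j k≢l lt)
  in ε , 0<ε , ev-map (λ {n} (h , g) → gap-convex i j k l n ε x y h g) ev

region-connected : (q : Point m) → Connected (Region q)
region-connected {m} q U V U-open V-open C⊆U∪V (u , u∈C , u∈U) (v , v∈C , v∈V) =
  meet U-open V-open (mkRealises λ {i} {j} {k} {l} i≢j k≢l lt →
    limit-gap i j k l (common-gap u v (realise u∈C i≢j k≢l lt) (realise v∈C i≢j k≢l lt)))
  where
  open Bisection {m} {Region q} {U} {V} (region-convex q) C⊆U∪V {u} {v} u∈C u∈U v∈C v∈V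
  limit-gap : ∀ i j k l → ∃[ ε ] 0ℚ < ε × Eventually (λ n →
      seq (u i) n + seq (u j) n + ε < seq (u k) n + seq (u l) n ×
      seq (v i) n + seq (v j) n + ε < seq (v k) n + seq (v l) n) →
    limit i ℝ.+ limit j <ᴿ limit k ℝ.+ limit l
  limit-gap i j k l (ε , 0<ε , ev) = ε , 0<ε , ev-map (λ {n} (h , g) →
    proj₁ (inherits (λ x → seq (x i) n + seq (x j) n + ε < seq (x k) n + seq (x l) n)
      (gap-convex i j k l n ε) {0} {n} (ℕ.≤⇒≤′ ℕ.z≤n) h g)) ev

region-component : {q : Point (3 ℕ.+ n)} → GenericQ q → Region q IsComponentOf ArrangementComplement
region-component {q = q} gen =
    (λ {x} real → genericR⇒complement {x = x} (realises⇒generic gen real))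
  , (const ∘ q , const-realises q)
  , region-connected q
  -- Maximality: `D` contains the rational point `const ∘ q`, and a connected set of generic points
  -- cannot leave the region of one of its points.
  , λ D D⊆compl D-conn region⊆D → connected⇒⊆region D-conn
      (λ {x} x∈D → complement⇒genericR {x = x} (D⊆compl x∈D))
      (region⊆D (const-realises q)) (const-realises q)

classes↔chambers : ∀ n → Bijection (DecSetoid.setoid (Chamber∼ (3 ℕ.+ n))) (Chambers (3 ℕ.+ n))
classes↔chambers n = mkBijection _ _ (λ (q , gen) → Region q , region-component gen)
  (λ {s} {t} q∼r → realises-cong (proj₂ s) q∼r , realises-cong (proj₂ t) (∼-sym (proj₂ s) q∼r))
  (λ {s} {t} (⊆ , _) → const-realises⇒∼ (proj₂ t) (⊆ (const-realises (proj₁ s))))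
  surj
  where
  surj : ∀ C → ∃[ s ] Setoid._≈_ (Chambers (3 ℕ.+ n))
      (Region (proj₁ s) , region-component (proj₂ s)) C
  surj (C , C⊆compl , (x , x∈C) , C-conn , C-max) =
    let q , gen , real = approximate {x = x} (complement⇒genericR {x = x} (C⊆compl x∈C))
        C⊆region : C ⊆ Region q
        C⊆region = connected⇒⊆region C-conn (λ {z} z∈C → complement⇒genericR {x = z} (C⊆compl z∈C))
            x∈C real
    in (q , gen) , C-max (Region q) (λ {z} z∈ →
        genericR⇒complement {x = z} (realises⇒generic gen z∈))
                     (region-connected q) C⊆region , C⊆region

-- Classes up to reflection are the ranking patterns

module _ {x y : ℝ^ (3 ℕ.+ n)} {q r : Point (3 ℕ.+ n)}
  (genq : GenericQ q) (genr : GenericQ r) (x-real : Realises x q) (y-real : Realises y r) where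

  RP-mono : SameRankings q r → ∀ {π} → RP x π → RP y π
  RP-mono incl {π} rp = admits⇒RP genr y-real {π} (incl π (RP⇒admits genq x-real {π} rp))

  RP-mono⁻ : (∀ {π} → RP x π → RP y π) → SameRankings q r
  RP-mono⁻ incl π adm = RP⇒admits genr y-real {π} (incl {π} (admits⇒RP genq x-real {π} adm))

≃⇒sameRankings : {q r : Point (3 ℕ.+ n)} → GenericQ q → GenericQ r → q ≃ r → SameRankings q r
≃⇒sameRankings gen genr (inj₁ q∼r) π adm = admits-cong gen q∼r adm
≃⇒sameRankings {r = r} gen genr (inj₂ q∼-r) π adm =
  admits-cong (neg-generic (neg-generic genr)) (neg-involutive r)
      (admits-neg (neg r) (admits-cong gen q∼-r adm))

pattern-of : {P : Subset (3 ℕ.+ n)} (q : Point (3 ℕ.+ n)) → const ∘ q ∈ P →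
    Setoid.Carrier (RankingPatterns P)
pattern-of q q∈P = RP (const ∘ q) , const ∘ q , q∈P , id , id

sameRankings⇒≐ : {q r : Point (3 ℕ.+ n)} → GenericQ q → GenericQ r → q ≃ r →
  RP (const ∘ q) ≐ RP (const ∘ r)
sameRankings⇒≐ {n} {q} {r} gen genr q≃r =
    (λ {π} → RP-mono gen genr (const-realises q) (const-realises r) (≃⇒sameRankings gen genr q≃r)
      {π})
  , (λ {π} → RP-mono genr gen (const-realises r) (const-realises q)
      (≃⇒sameRankings genr gen (DecSetoid.sym (Pattern≃ (3 ℕ.+ n)) {q , gen} {r , genr} q≃r)) {π})

≐⇒≃ : {q r : Point (3 ℕ.+ n)} → GenericQ q → GenericQ r → RP (const ∘ q) ≐ RP (const ∘ r) → q ≃ r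
≐⇒≃ {q = q} {r} gen genr (⊆ , _) = sameRankings⇒∼⊎∼neg gen genr
  (RP-mono⁻ gen genr (const-realises q) (const-realises r) (λ {π} → ⊆ {π}))

const-generic : {q : Point (3 ℕ.+ n)} → GenericQ q → Generic (const ∘ q)
const-generic {q = q} gen = genericR⇒generic (realises⇒generic gen (const-realises q))

approximate-pattern : (x : ℝ^ (3 ℕ.+ n)) {q : Point (3 ℕ.+ n)} → GenericQ q → Realises x q →
  RP (const ∘ q) ≐ RP x
approximate-pattern x {q} gen real =
    (λ {π} → RP-mono gen gen (const-realises q) real (λ _ → id) {π})
  , (λ {π} → RP-mono gen gen real (const-realises q) (λ _ → id) {π})

≐-trans : {A : Set} {P Q R : A → Set} → P ≐ Q → Q ≐ R → P ≐ R
≐-trans (f , f′) (g , g′) = (g ∘ f) , (f′ ∘ g′)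

≐-sym : {A : Set} {P Q : A → Set} → P ≐ Q → Q ≐ P
≐-sym (f , g) = g , f

classes↔patterns : ∀ n → Bijection (DecSetoid.setoid (Pattern≃ (3 ℕ.+ n)))
    (RankingPatterns {3 ℕ.+ n} Generic)
classes↔patterns n = mkBijection _ _ (λ (q , gen) → pattern-of q (const-generic gen))
  (λ {s} {t} → sameRankings⇒≐ (proj₂ s) (proj₂ t))
  (λ {s} {t} → ≐⇒≃ (proj₂ s) (proj₂ t))
  λ (S , x , x-gen , S≐) → let q , gen , real = approximate {x = x} (generic⇒genericR {x = x} x-gen) in
    (q , gen) , ≐-trans (approximate-pattern x gen real) (≐-sym S≐)

-- The mirror image of an increasing configuration is decreasing, so among increasing ones the
-- reflection ambiguity of patterns disappears.
increasing↔patterns : ∀ n → Bijection (DecSetoid.setoid (Increasing∼ (3 ℕ.+ n)))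
  (RankingPatterns {3 ℕ.+ n} (Generic ∩ Increasing))
increasing↔patterns n = mkBijection _ _
  (λ (q , gen , inc) → pattern-of q (const-generic gen , λ i j i<j → const-<ᴿ (inc i j i<j)))
  (λ {(_ , genq , _)} {(_ , genr , _)} q∼r → sameRankings⇒≐ genq genr (inj₁ q∼r))
  (λ {(_ , genq , q-inc)} {(_ , genr , r-inc)} eq → noReflection q-inc r-inc (≐⇒≃ genq genr eq))
  λ (S , x , (x-gen , x-inc) , S≐) → let q , gen , real = approximate {x = x} (generic⇒genericR {x = x} x-gen) in
    (q , gen , λ i j i<j → realises⇒order⁻ {x = x} gen real {i} {j} (x-inc i j i<j))
    , ≐-trans (approximate-pattern x gen real) (≐-sym S≐)
  where
  noReflection : {q r : Point (3 ℕ.+ n)} → Sorted q id → Sorted r id → q ≃ r → q ∼ r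
  noReflection q-inc r-inc (inj₁ q∼r)  = q∼r
  noReflection q-inc r-inc (inj₂ q∼-r) = contradiction (r-inc zero (suc zero) ℕ.z<s)
    (ℚ.<-asym (neg-order (∼⇒order q∼-r {zero} {suc zero} (q-inc zero (suc zero) ℕ.z<s))))

-- Comparing the three counts

theorem3p2 : (m : ℕ) → 3 ≤ m →
    ∃[ r ] ∃[ r₀ ] ∃[ c ]
    RankingPatterns {m} Generic HasCardinality r ×
    RankingPatterns {m} (Generic ∩ Increasing) HasCardinality r₀ ×
    Chambers m HasCardinality c ×
    2 * r ≡ m ! * r₀ ×
    2 * r ≡ c
theorem3p2 _ (ℕ.s≤s (ℕ.s≤s (ℕ.s≤s {n = n} _))) =
  let m = 3 ℕ.+ n
      r  , r-card  = pattern≃-finite m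
      r₀ , r₀-card = increasing∼-finite n
      c  , c-card  = chamber∼-finite m
      -- Both equations hold because a cardinality is unique: the rational classes are matched with
      -- sides times patterns here, and with permutations times increasing classes below.
      2r≡c : 2 * r ≡ c
      2r≡c = card-unique (≡.setoid (Fin 2) ×ₛ DecSetoid.setoid (Pattern≃ m))
        (card-× (id-bijection (≡.setoid (Fin 2))) r-card)
        (bijection c-card (chambers↔sides×patterns n))
      m!r₀≡c : m ! * r₀ ≡ c
      m!r₀≡c = card-unique (DecSetoid.setoid (Chamber∼ m))
        (bijection (card-× (permutations-card m) r₀-card) (perms×increasing↔chambers n)) c-card
  in r , r₀ , c
   , bijection r-card (classes↔patterns n)
   , bijection r₀-card (increasing↔patterns n)
   , bijection c-card (classes↔chambers n)
   , ≡.trans 2r≡c (≡.sym m!r₀≡c) , 2r≡c
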